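{- An $AB\bar B$-formula $\varphi$ is satisfied by some infinite interval structure if and only if it is featured by some periodic $\varphi$-compass structure with threshold $\tilde y_0<2^{2^{7|\varphi|}}$ and period $\tilde y<2|\varphi|\cdot 2^{2^{7|\varphi|}}\cdot 2^{2^{7|\varphi|}}$.
   Context: Syntax: $AB\bar B$-formulas are built from a set $\mathcal{P}$ of propositional variables using $\neg$, $\vee$ and unary modalities $\langle A\rangle,\langle B\rangle,\langle\bar B\rangle$ ($[R]\psi=\neg\langle R\rangle\neg\psi$); $|\varphi|$ is the size (number of subformulas) of $\varphi$. Semantics: an ordinal $N\le\omega$ is identified with $\{0,\dots,N-1\}$ ($\mathbb{N}$ if $N=\omega$); $\mathbb{I}_N$ is the set of intervals $[x,y]$ with $x,y\in N$, $x<y$. $[x,y]\,A\,[x',y']$ iff $y=x'$; $[x,y]\,B\,[x',y']$ iff $x=x'$ and $y'<y$; $[x,y]\,\bar B\,[x',y']$ iff $x=x'$ and $y<y'$. An interval structure $\mathcal{S}=(\mathbb{I}_N,A,B,\bar B,\sigma)$ has $\sigma:\mathbb{I}_N\to\mathcal{P}(\mathcal{P})$; it is infinite if $N=\omega$. $\mathcal{S},I\models p$ iff $p\in\sigma(I)$; booleans as usual; $\mathcal{S},I\models\langle R\rangle\psi$ iff some $J$ with $I\,R\,J$ has $\mathcal{S},J\models\psi$. $\mathcal{S}$ satisfies $\varphi$ if $\mathcal{S},I\models\varphi$ for some $I$. Atoms: $Cl(\varphi)$ is the set of subformulas of $\varphi$ and their negations (identifying $\neg\neg\alpha$ with $\alpha$,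 $\neg\langle R\rangle\alpha$ with $[R]\neg\alpha$); $Cl^+(\varphi)$ adds all $\langle R\rangle\alpha$, $\neg\langle R\rangle\alpha$ for $R\in\{A,B,\bar B\}$, $\alpha\in Cl(\varphi)$. A $\varphi$-atom is a nonempty $F\subseteq Cl^+(\varphi)$ with: $\alpha\in F$ iff $\neg\alpha\notin F$ for all $\alpha\in Cl^+(\varphi)$, and $\alpha\vee\beta\in F$ iff $\alpha\in F$ or $\beta\in F$. $obs(F)=\{\alpha\in Cl(\varphi):\alpha\in F\}$, $Req_R(F)=\{\alpha\in Cl(\varphi):\langle R\rangle\alpha\in F\}$. $F\leadsto_A G$ iff $Req_A(F)=obs(G)\cup Req_B(G)\cup Req_{\bar B}(G)$; $F\leadsto_B G$ iff $obs(F)\cup Req_{\bar B}(F)\subseteq Req_{\bar B}(G)\subseteq obs(F)\cup Req_{\bar B}(F)\cup Req_B(F)$ and $obs(G)\cup Req_B(G)\subseteq Req_B(F)\subseteq obs(G)\cup Req_B(G)\cup Req_{\bar B}(G)$. Compass structures: $\mathbb{P}_N=\{(x,y):0\le x<y<N\}$ with relations $A,B,\bar B$ as for the intervals $[x,y]$. A $\varphi$-compass structure of length $N$ is $(\mathbb{P}_N,\mathcal{L})$, $\mathcal{L}$ mapping points to $\varphi$-atoms, such that $p\,R\,q$ implies $\mathcal{L}(p)\leadsto_R\mathcal{L}(q)$ for $R\in\{A,B\}$ (consistency), and for every $p$, $R\in\{A,B,\bar B\}$, $\alpha\in Req_R(\mathcal{L}(p))$ there is $q$ with $p\,R\,q$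 and $\alpha\in obs(\mathcal{L}(q))$ (fulfillment). It features $\alpha$ if $\alpha\in\mathcal{L}(p)$ for some $p$. Periodicity: an infinite compass structure $(\mathbb{P}_\omega,\mathcal{L})$ is periodic with threshold $\tilde y_0$, period $\tilde y$ and binding $\tilde g:\{0,\dots,\tilde y_0+\tilde y-1\}\to\{0,\dots,\tilde y_0-1\}$ if (i) for all $\tilde y_0+\tilde y\le x<y$, $\mathcal{L}(x,y)=\mathcal{L}(x-\tilde y,y-\tilde y)$, and (ii) for all $0\le x<\tilde y_0+\tilde y\le y$, $\mathcal{L}(x,y)=\mathcal{L}(\tilde g(x),y-\tilde y)$. -}

module Defs where

open import Data.Fin.Base using (Fin; toℕ)
open import Data.Fin.Properties using (toℕ<n)
open import Data.List.Base using (List; []; _∷_; _++_; length; deduplicate)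
open import Data.List.Membership.Propositional using () renaming (_∈_ to _∈ˡ_)
open import Data.Nat.Base using (ℕ; _+_; _∸_; _≤_; _<_)
open import Data.Nat.Properties
  using (<-≤-trans; ∸-monoˡ-<; m+n≤o⇒m≤o∸n; m+n≤o⇒n≤o)
open import Data.Product.Base using (∃-syntax; _×_)
open import Data.Sum.Base using (_⊎_)
open import Function.Bundles using (_⇔_)
open import Level using (0ℓ)
open import Relation.Binary.Core using (Rel)
open import Relation.Binary.Definitions using (DecidableEquality; _Respects_)
open import Relation.Binary.PropositionalEquality.Core using (_≡_; refl)
open import Relation.Nullary.Decidable.Core using (yes; no)
open import Relation.Nullary.Negation.Core using (¬_)
open import Relation.Unary
  using (Pred; _∈_; _∉_; _⊆_; _≐_; _∩_; _∪_; _⊢_; Satisfiable)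

private
  variable
    𝒫 : Set

------------------------------------------------------------------------
-- Syntax

data Modality : Set where
  A B B̄ : Modality

infix  20 ∼_
infix  20 ⟨_⟩_ ⟦_⟧_
infixr 15 _∨_

data Formula (𝒫 : Set) : Set where
  var  : 𝒫 → Formula 𝒫
  ∼_   : Formula 𝒫 → Formula 𝒫
  _∨_  : Formula 𝒫 → Formula 𝒫 → Formula 𝒫
  ⟨_⟩_ : Modality → Formula 𝒫 → Formula 𝒫

⟦_⟧_ : Modality → Formula 𝒫 → Formula 𝒫
⟦ R ⟧ α = ∼ ⟨ R ⟩ ∼ α

subformulas : Formula 𝒫 → List (Formula 𝒫)
subformulas φ@(var _)   = φ ∷ []
subformulas φ@(∼ α)     = φ ∷ subformulas α
subformulas φ@(α ∨ β)   = φ ∷ subformulas α ++ subformulas β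
subformulas φ@(⟨ _ ⟩ α) = φ ∷ subformulas α

≡-decᴹ : DecidableEquality Modality
≡-decᴹ A A = yes refl
≡-decᴹ A B = no λ ()
≡-decᴹ A B̄ = no λ ()
≡-decᴹ B A = no λ ()
≡-decᴹ B B = yes refl
≡-decᴹ B B̄ = no λ ()
≡-decᴹ B̄ A = no λ ()
≡-decᴹ B̄ B = no λ ()
≡-decᴹ B̄ B̄ = yes refl

≡-decᶠ : DecidableEquality 𝒫 → DecidableEquality (Formula 𝒫)
≡-decᶠ _≟_ (var p) (var q) with p ≟ q
... | yes refl = yes refl
... | no p≢q   = no λ { refl → p≢q refl }
≡-decᶠ _≟_ (∼ α) (∼ β) with ≡-decᶠ _≟_ α β
... | yes refl = yes refl
... | no α≢β   = no λ { refl → α≢β refl }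
≡-decᶠ _≟_ (α ∨ β) (γ ∨ δ) with ≡-decᶠ _≟_ α γ | ≡-decᶠ _≟_ β δ
... | yes refl | yes refl = yes refl
... | no α≢γ   | _        = no λ { refl → α≢γ refl }
... | yes _    | no β≢δ   = no λ { refl → β≢δ refl }
≡-decᶠ _≟_ (⟨ R ⟩ α) (⟨ S ⟩ β) with ≡-decᴹ R S | ≡-decᶠ _≟_ α β
... | yes refl | yes refl = yes refl
... | no R≢S   | _        = no λ { refl → R≢S refl }
... | yes _    | no α≢β   = no λ { refl → α≢β refl }
≡-decᶠ _ (var _)   (∼ _)     = no λ ()
≡-decᶠ _ (var _)   (_ ∨ _)   = no λ ()
≡-decᶠ _ (var _)   (⟨ _ ⟩ _) = no λ ()
≡-decᶠ _ (∼ _)     (var _)   = no λ ()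
≡-decᶠ _ (∼ _)     (_ ∨ _)   = no λ ()
≡-decᶠ _ (∼ _)     (⟨ _ ⟩ _) = no λ ()
≡-decᶠ _ (_ ∨ _)   (var _)   = no λ ()
≡-decᶠ _ (_ ∨ _)   (∼ _)     = no λ ()
≡-decᶠ _ (_ ∨ _)   (⟨ _ ⟩ _) = no λ ()
≡-decᶠ _ (⟨ _ ⟩ _) (var _)   = no λ ()
≡-decᶠ _ (⟨ _ ⟩ _) (∼ _)     = no λ ()
≡-decᶠ _ (⟨ _ ⟩ _) (_ ∨ _)   = no λ ()

-- Distinct subformulas are counted, not occurrences.
size : DecidableEquality 𝒫 → Formula 𝒫 → ℕ
size _≟_ φ = length (deduplicate (≡-decᶠ _≟_) (subformulas φ))

------------------------------------------------------------------------
-- Intervals over ω and their relations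

-- The irrelevant field makes intervals with equal endpoints equal.
record Interval : Set where
  constructor [_,_]⟨_⟩
  field
    left right  : ℕ
    .left<right : left < right

open Interval public

-- Rel⟦ R ⟧ I J is the relation written I R J.
Rel⟦_⟧ : Modality → Rel Interval 0ℓ
Rel⟦ A ⟧ I J = right I ≡ left J
Rel⟦ B ⟧ I J = left I ≡ left J × right J < right I
Rel⟦ B̄ ⟧ I J = left I ≡ left J × right I < right J

------------------------------------------------------------------------
-- Infinite interval structures

record InfiniteIntervalStructure (𝒫 : Set) : Set₁ where
  field
    σ : Interval → Pred 𝒫 0ℓ

open InfiniteIntervalStructure public

infix 4 _,_⊨_ _Satisfies_

_,_⊨_ : InfiniteIntervalStructure 𝒫 → Interval → Formula 𝒫 → Set
𝓢 , I ⊨ var p     = p ∈ σ 𝓢 I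
𝓢 , I ⊨ ∼ α       = ¬ (𝓢 , I ⊨ α)
𝓢 , I ⊨ α ∨ β     = (𝓢 , I ⊨ α) ⊎ (𝓢 , I ⊨ β)
𝓢 , I ⊨ (⟨ R ⟩ α) = ∃[ J ] Rel⟦ R ⟧ I J × (𝓢 , J ⊨ α)

_Satisfies_ : InfiniteIntervalStructure 𝒫 → Formula 𝒫 → Set
𝓢 Satisfies φ = ∃[ I ] (𝓢 , I ⊨ φ)

------------------------------------------------------------------------
-- Closures and atoms

-- The identification of formulas used in closures, as a congruence:
-- formulas are only considered up to _≈_ below, and sets of formulas
-- are predicates respecting it.  (The rule ¬⟨⟩≈[]¬ is in fact
-- derivable from the others.)
infix 4 _≈_

data _≈_ {𝒫 : Set} : Rel (Formula 𝒫) 0ℓ where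
  ≈-refl   : ∀ {α} → α ≈ α
  ≈-sym    : ∀ {α β} → α ≈ β → β ≈ α
  ≈-trans  : ∀ {α β γ} → α ≈ β → β ≈ γ → α ≈ γ
  ∼-cong   : ∀ {α β} → α ≈ β → ∼ α ≈ ∼ β
  ∨-cong   : ∀ {α β γ δ} → α ≈ β → γ ≈ δ → α ∨ γ ≈ β ∨ δ
  ⟨⟩-cong  : ∀ {R α β} → α ≈ β → ⟨ R ⟩ α ≈ ⟨ R ⟩ β
  ¬¬≈      : ∀ {α} → ∼ ∼ α ≈ α
  ¬⟨⟩≈[]¬  : ∀ {R α} → ∼ ⟨ R ⟩ α ≈ ⟦ R ⟧ ∼ α

Cl : Formula 𝒫 → Pred (Formula 𝒫) 0ℓ
Cl φ α = ∃[ β ] β ∈ˡ subformulas φ × (α ≈ β ⊎ α ≈ ∼ β)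

Cl⁺ : Formula 𝒫 → Pred (Formula 𝒫) 0ℓ
Cl⁺ φ α =
  α ∈ Cl φ ⊎
  (∃[ R ] ∃[ β ] β ∈ Cl φ × (α ≈ ⟨ R ⟩ β ⊎ α ≈ ∼ ⟨ R ⟩ β))

record IsAtom (φ : Formula 𝒫) (F : Pred (Formula 𝒫) 0ℓ) : Set where
  field
    respects-≈  : F Respects _≈_
    nonempty    : Satisfiable F
    F⊆Cl⁺       : F ⊆ Cl⁺ φ
    negation    : ∀ {α} → α ∈ Cl⁺ φ → (α ∈ F) ⇔ (∼ α ∉ F)
    disjunction : ∀ {α β} → α ∨ β ∈ Cl⁺ φ →
                  (α ∨ β ∈ F) ⇔ (α ∈ F ⊎ β ∈ F)

module _ (φ : Formula 𝒫) where

  obs : Pred (Formula 𝒫) 0ℓ → Pred (Formula 𝒫) 0ℓ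
  obs F = Cl φ ∩ F

  Req : Modality → Pred (Formula 𝒫) 0ℓ → Pred (Formula 𝒫) 0ℓ
  Req R F = Cl φ ∩ (⟨ R ⟩_ ⊢ F)

  infix 4 _⇝A_ _⇝B_

  _⇝A_ : Pred (Formula 𝒫) 0ℓ → Pred (Formula 𝒫) 0ℓ → Set
  F ⇝A G = Req A F ≐ obs G ∪ Req B G ∪ Req B̄ G

  _⇝B_ : Pred (Formula 𝒫) 0ℓ → Pred (Formula 𝒫) 0ℓ → Set
  F ⇝B G =
    (obs F ∪ Req B̄ F ⊆ Req B̄ G) ×
    (Req B̄ G ⊆ obs F ∪ Req B̄ F ∪ Req B F) ×
    (obs G ∪ Req B G ⊆ Req B F) ×
    (Req B F ⊆ obs G ∪ Req B G ∪ Req B̄ G)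

------------------------------------------------------------------------
-- Infinite compass structures

-- The point (x , y) of ℙ_ω is the interval [x , y].
Point : Set
Point = Interval

record InfiniteCompassStructure (φ : Formula 𝒫) : Set₁ where
  field
    𝓛            : Point → Pred (Formula 𝒫) 0ℓ
    atom         : ∀ p → IsAtom φ (𝓛 p)
    consistencyA : ∀ {p q} → Rel⟦ A ⟧ p q → _⇝A_ φ (𝓛 p) (𝓛 q)
    consistencyB : ∀ {p q} → Rel⟦ B ⟧ p q → _⇝B_ φ (𝓛 p) (𝓛 q)
    fulfillment  : ∀ p R {α} → α ∈ Req φ R (𝓛 p) →
                   ∃[ q ] Rel⟦ R ⟧ p q × α ∈ obs φ (𝓛 q)

open InfiniteCompassStructure public

infix 4 _Features_

_Features_ : {φ : Formula 𝒫} → InfiniteCompassStructure φ → Formula 𝒫 → Set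
𝓒 Features α = ∃[ p ] α ∈ 𝓛 𝓒 p

-- Equality of labels is extensional equality of sets.  A period is
-- positive by definition: with ỹ = 0 and g̃ the identity, both
-- conditions would hold of every compass structure.
record IsPeriodic {φ : Formula 𝒫} (𝓒 : InfiniteCompassStructure φ)
                  (ỹ₀ ỹ : ℕ) (g̃ : Fin (ỹ₀ + ỹ) → Fin ỹ₀) : Set where
  field
    ỹ>0      : 0 < ỹ
    periodic : ∀ {x y} (x≥ : ỹ₀ + ỹ ≤ x) (x<y : x < y) →
      𝓛 𝓒 [ x , y ]⟨ x<y ⟩
      ≐ 𝓛 𝓒 [ x ∸ ỹ , y ∸ ỹ ]⟨ ∸-monoˡ-< x<y (m+n≤o⇒n≤o ỹ₀ x≥) ⟩
    binding  : ∀ (x : Fin (ỹ₀ + ỹ)) {y} (y≥ : ỹ₀ + ỹ ≤ y) →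
      𝓛 𝓒 [ toℕ x , y ]⟨ <-≤-trans (toℕ<n x) y≥ ⟩
      ≐ 𝓛 𝓒 [ toℕ (g̃ x) , y ∸ ỹ ]⟨
            <-≤-trans (toℕ<n (g̃ x)) (m+n≤o⇒m≤o∸n ỹ₀ y≥) ⟩

Periodic : {φ : Formula 𝒫} → InfiniteCompassStructure φ → ℕ → ℕ → Set
Periodic 𝓒 ỹ₀ ỹ = ∃[ g̃ ] IsPeriodic 𝓒 ỹ₀ ỹ g̃

{-# OPTIONS --safe #-}

-- A compass structure yields a model of φ by reading off its
-- variables.  For the converse, give every interval of a model 𝓢 of φ
-- the code recording which of 7|φ| formulas hold there; there are
-- m = 2^(7|φ|) codes.  A passage from row s to row s + 1 of 𝓢 acts as a
-- letter: it sends the code of each old column to its code one row up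
-- and opens one new column.  Letters act on the sets of codes found in
-- a row, and an infinite word over letters that are valid (copied from
-- 𝓢) describes a new structure row by row.  All formulas keep
-- their truth value along codes, provided that every ⟨B̄⟩-request is
-- eventually met; this is the only condition that is not local.
--
-- From the empty set go to a set T* which is terminal: it can be
-- reached back from everything it reaches.  From T*, copying enough
-- rows of 𝓢 meets any one request, so some word w from T* meets all
-- requests of T* and then returns to T*.  The word u w w w …, where u
-- leads to T*, is periodic with threshold |u| and period |w|.  Deleting
-- loops makes |u| < 2^m and bounds w by one segment of length at most
-- 2^m m (loops on a set with a tracked code) for each of the m · 2|φ|
-- possible requests, and a way back shorter than 2^m.
module Submission where

open import Defs
open import Axiom.DoubleNegationElimination using (em⇒dne)
open import Axiom.ExcludedMiddle using (ExcludedMiddle)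
open import Data.Bool.Base using (Bool; true; false)
import Data.Empty as Empty
open import Data.Fin.Base using (Fin; zero; suc; toℕ; combine; fromℕ<)
open import Data.Fin.Properties
  using (any?; combine-injective; pigeonhole; toℕ<n; toℕ-fromℕ<)
  renaming (_≟_ to _≟ᶠ_)
open import Data.Fin.Subset using (Subset; Nonempty; ⊥) renaming (_∈_ to _∈ˢ_)
open import Data.Fin.Subset.Properties using (_∈?_; ∉⊥)
open import Data.List.Base
  using (List; []; _∷_; _++_; length; map; foldl; take; drop; deduplicate;
         allFin; cartesianProduct)
  renaming (lookup to lookupˡ)
open import Data.List.Membership.Propositional using () renaming (_∈_ to _∈ˡ_)
open import Data.List.Membership.Propositional.Properties
  using (∈-++⁺ˡ; ∈-++⁺ʳ; ∈-++⁻; ∈-map⁺; ∈-map⁻; ∈-deduplicate⁺; ∈-allFin;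
         ∈-cartesianProduct⁺; ∈-cartesianProduct⁻)
open import Data.List.Properties
  using (length-map; length-++; length-take; length-drop; length-tabulate;
         take++drop≡id; foldl-++)
open import Data.List.Relation.Unary.All as All using (All; []; _∷_)
open import Data.List.Relation.Unary.Any using (here; there; index)
open import Data.List.Relation.Unary.Any.Properties using (lookup-index)
open import Data.Nat.Base
open import Data.Nat.Induction using (<-wellFounded)
open import Data.Nat.Properties renaming (_≟_ to _≟ⁿ_)
open import Data.Nat.Tactic.RingSolver using (solve-∀)
open import Data.Product.Base
  using (Σ; Σ-syntax; ∃-syntax; _×_; _,_; proj₁; proj₂; map₂)
open import Data.Sum.Base using (_⊎_; inj₁; inj₂; [_,_]′) renaming (map to ⊎-map)
open import Data.Vec.Base using (Vec; []; _∷_; lookup; tabulate)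
open import Data.Vec.Properties using (lookup∘tabulate; []=⇒lookup; lookup⇒[]=)
open import Function.Base using (_∘_; _$_; id; it)
open import Function.Bundles using (_⇔_; mk⇔; Equivalence)
open import Function.Definitions using (Injective)
open import Induction.WellFounded using (Acc; acc)
open import Level using (0ℓ)
open import Relation.Binary.Core using (Rel)
open import Relation.Binary.Definitions
  using (DecidableEquality; Transitive; tri<; tri≈; tri>)
open import Relation.Binary.PropositionalEquality
open import Relation.Nullary.Decidable
  using (Dec; yes; no; does; _⊎-dec_; _×-dec_; dec-true; recompute)
open import Relation.Nullary.Negation using (¬_; contradiction)
open import Relation.Unary using (Pred; Decidable; Satisfiable; _∈_; _≐_)

-- Finite codes and terminal elements of preorders

bit : Bool → Fin 2
bit false = zero
bit true  = suc zero

bit-injective : ∀ {a b} → bit a ≡ bit b → a ≡ b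
bit-injective {false} {false} _ = refl
bit-injective {true}  {true}  _ = refl

encode : ∀ {k} → Vec Bool k → Fin (2 ^ k)
encode []      = zero
encode (b ∷ v) = combine (bit b) (encode v)

encode-injective : ∀ {k} {u v : Vec Bool k} → encode u ≡ encode v → u ≡ v
encode-injective {u = []}    {[]}    _ = refl
encode-injective {u = a ∷ u} {b ∷ v} e
  with p , q ← combine-injective (bit a) (encode u) (bit b) (encode v) e
  = cong₂ _∷_ (bit-injective p) (encode-injective q)

⟪_⟫ : ∀ {m} {P : Fin m → Set} → Decidable P → Subset m
⟪ P? ⟫ = tabulate (λ i → does (P? i))

module _ {m} {P : Fin m → Set} (P? : Decidable P) where

  ∈⟪⟫⁺ : ∀ {i} → P i → i ∈ˢ ⟪ P? ⟫
  ∈⟪⟫⁺ {i} pi = lookup⇒[]= i _ (trans (lookup∘tabulate _ i) (dec-true (P? i) pi))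

  ∈⟪⟫⁻ : ∀ {i} → i ∈ˢ ⟪ P? ⟫ → P i
  ∈⟪⟫⁻ {i} i∈ with P? i | trans (sym (lookup∘tabulate (does ∘ P?) i)) ([]=⇒lookup i∈)
  ... | yes pi | _ = pi

-- Otherwise from every element above `x` one can climb to an element with no way back. Among
-- `K + 1` members of such a chain two coincide, and the chain itself then provides a forbidden way
-- back.
terminal : ExcludedMiddle 0ℓ →
           ∀ {X : Set} {K} (enc : X → Fin K) → Injective _≡_ _≡_ enc →
           {_≲_ : Rel X 0ℓ} → (∀ {x} → x ≲ x) → Transitive _≲_ →
           ∀ x → ∃[ y ] x ≲ y × (∀ z → y ≲ z → z ≲ y)
terminal em {X} {K} enc enc-inj {_≲_} ≲-refl ≲-trans x = em⇒dne em refute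
  where
  refute : ¬ ¬ (∃[ y ] x ≲ y × (∀ z → y ≲ z → z ≲ y))
  refute none =
    let i , j , i<j , eq = pigeonhole (n<1+n K) (enc ∘ proj₁ ∘ chain ∘ toℕ)
    in no-return (toℕ i)
         (subst (proj₁ (chain (suc (toℕ i))) ≲_) (sym (enc-inj eq)) (ascending (≤⇒≤′ i<j)))
    where
    climb : ∀ y → x ≲ y → ∃[ z ] y ≲ z × ¬ z ≲ y
    climb y x≲y = em⇒dne em λ stuck →
      none (y , x≲y , λ z y≲z → em⇒dne em λ z≴y → stuck (z , y≲z , z≴y))

    chain : ℕ → Σ X (x ≲_)
    chain zero    = x , ≲-refl
    chain (suc n) with y , x≲y ← chain n with z , y≲z , _ ← climb y x≲y = z , ≲-trans x≲y y≲z

    ascends : ∀ n → proj₁ (chain n) ≲ proj₁ (chain (suc n))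
    ascends n = proj₁ (proj₂ (climb (proj₁ (chain n)) (proj₂ (chain n))))

    no-return : ∀ n → ¬ proj₁ (chain (suc n)) ≲ proj₁ (chain n)
    no-return n = proj₂ (proj₂ (climb (proj₁ (chain n)) (proj₂ (chain n))))

    ascending : ∀ {i j} → i ≤′ j → proj₁ (chain i) ≲ proj₁ (chain j)
    ascending ≤′-refl                   = ≲-refl
    ascending {j = suc j} (≤′-step i≤j) = ≲-trans (ascending i≤j) (ascends j)

-- Runs and the removal of loops

module Automaton {X L : Set} (_·_ : X → L → X) (Valid : X → L → Set) where

  run : X → List L → X
  run = foldl _·_

  data Run : X → List L → Set where
    []  : ∀ {x} → Run x []
    _∷_ : ∀ {x l ls} → Valid x l → Run (x · l) ls → Run x (l ∷ ls)

  Run-++ : ∀ {x ls ls′} → Run x ls → Run (run x ls) ls′ → Run x (ls ++ ls′)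
  Run-++ []      r′ = r′
  Run-++ (v ∷ r) r′ = v ∷ Run-++ r r′

  Run-take : ∀ n {x ls} → Run x ls → Run x (take n ls)
  Run-take zero    r       = []
  Run-take (suc n) []      = []
  Run-take (suc n) (v ∷ r) = v ∷ Run-take n r

  Run-drop : ∀ n {x ls} → Run x ls → Run (run x (take n ls)) (drop n ls)
  Run-drop zero    r       = r
  Run-drop (suc n) []      = []
  Run-drop (suc n) (v ∷ r) = Run-drop n r

  -- A word with at least `K` letters has more than `K` prefixes, so two of them lead to the same
  -- state. The loop between them is cut out, and the argument is repeated on the shorter word.
  shorten : ∀ {K} (enc : X → Fin K) → Injective _≡_ _≡_ enc →
            ∀ {x ls} → Run x ls →
            ∃[ ls′ ] Run x ls′ × run x ls′ ≡ run x ls × length ls′ < K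
  shorten {K} enc enc-inj {x} r = go r (<-wellFounded _)
    where
    go : ∀ {ls} → Run x ls → Acc _<_ (length ls) →
         ∃[ ls′ ] Run x ls′ × run x ls′ ≡ run x ls × length ls′ < K
    go {ls} r (acc rec) with length ls <? K
    ... | yes short = ls , r , refl , short
    ... | no ¬short with pigeonhole (s≤s (≮⇒≥ ¬short)) (λ i → enc (run x (take (toℕ i) ls)))
    ... | i , j , i<j , eq = ls″ , r″ , trans end″ end , short″
      where
      same : run x (take (toℕ i) ls) ≡ run x (take (toℕ j) ls)
      same = enc-inj eq

      cut : List L
      cut = take (toℕ i) ls ++ drop (toℕ j) ls

      j≤ : toℕ j ≤ length ls
      j≤ = ≤-pred (toℕ<n j)

      cut-shorter : length cut < length ls
      cut-shorter = begin-strict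
        length cut                        ≡⟨ length-++ (take (toℕ i) ls) ⟩
        length (take (toℕ i) ls) + length (drop (toℕ j) ls)
          ≡⟨ cong₂ _+_ (length-take (toℕ i) ls) (length-drop (toℕ j) ls) ⟩
        toℕ i ⊓ length ls + (length ls ∸ toℕ j)
          ≤⟨ +-monoˡ-≤ _ (m⊓n≤m (toℕ i) (length ls)) ⟩
        toℕ i + (length ls ∸ toℕ j)       <⟨ +-monoˡ-< _ i<j ⟩
        toℕ j + (length ls ∸ toℕ j)       ≡⟨ m+[n∸m]≡n j≤ ⟩
        length ls                         ∎
        where open ≤-Reasoning

      cut-run : Run x cut
      cut-run = Run-++ (Run-take (toℕ i) r)
        (subst (λ y → Run y (drop (toℕ j) ls)) (sym same) (Run-drop (toℕ j) r))

      end : run x cut ≡ run x ls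
      end = begin
        run x cut                                          ≡⟨ foldl-++ _·_ x (take (toℕ i) ls) _ ⟩
        run (run x (take (toℕ i) ls)) (drop (toℕ j) ls)    ≡⟨ cong (λ y → run y (drop (toℕ j) ls)) same ⟩
        run (run x (take (toℕ j) ls)) (drop (toℕ j) ls)    ≡⟨ foldl-++ _·_ x (take (toℕ j) ls) _ ⟨
        run x (take (toℕ j) ls ++ drop (toℕ j) ls)         ≡⟨ cong (run x) (take++drop≡id (toℕ j) ls) ⟩
        run x ls                                           ∎
        where open ≡-Reasoning

      shorter = go cut-run (rec cut-shorter)
      ls″    = proj₁ shorter
      r″     = proj₁ (proj₂ shorter)
      end″   = proj₁ (proj₂ (proj₂ shorter))
      short″ = proj₂ (proj₂ (proj₂ shorter))

-- Subformulas, the congruence `≈` and closures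

private
  variable
    𝒫 : Set
    α β γ φ ψ : Formula 𝒫

∈-subformulas-refl : (α : Formula 𝒫) → α ∈ˡ subformulas α
∈-subformulas-refl (var _)   = here refl
∈-subformulas-refl (∼ _)     = here refl
∈-subformulas-refl (_ ∨ _)   = here refl
∈-subformulas-refl (⟨ _ ⟩ _) = here refl

∈-subformulas-trans : α ∈ˡ subformulas β → β ∈ˡ subformulas γ → α ∈ˡ subformulas γ
∈-subformulas-trans {γ = var _}   a (here refl) = a
∈-subformulas-trans {γ = ∼ _}     a (here refl) = a
∈-subformulas-trans {γ = ∼ _}     a (there b)   = there (∈-subformulas-trans a b)
∈-subformulas-trans {γ = _ ∨ _}   a (here refl) = a
∈-subformulas-trans {γ = γ ∨ δ}   a (there b) with ∈-++⁻ (subformulas γ) b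
... | inj₁ b∈ = there (∈-++⁺ˡ (∈-subformulas-trans a b∈))
... | inj₂ b∈ = there (∈-++⁺ʳ (subformulas γ) (∈-subformulas-trans a b∈))
∈-subformulas-trans {γ = ⟨ _ ⟩ _} a (here refl) = a
∈-subformulas-trans {γ = ⟨ _ ⟩ _} a (there b)   = there (∈-subformulas-trans a b)

-- Negations are the only constructor that ≈ can add or remove, so ≈ is
-- inverted after stripping them.
strip : Formula 𝒫 → Formula 𝒫
strip (∼ α) = strip α
strip α     = α

-- Only disjunctions are going to be inverted, so only they keep their arguments; the other heads
-- just have to be told apart from `∨`.
data SameHead {𝒫 : Set} : Formula 𝒫 → Formula 𝒫 → Set where
  var : ∀ {p q} → SameHead (var p) (var q)
  _∨_ : ∀ {α β γ δ} → α ≈ γ → β ≈ δ → SameHead (α ∨ β) (γ ∨ δ)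
  ⟨⟩  : ∀ {R S α β} → SameHead (⟨ R ⟩ α) (⟨ S ⟩ β)

SameHead-sym : SameHead α β → SameHead β α
SameHead-sym var     = var
SameHead-sym (a ∨ b) = ≈-sym a ∨ ≈-sym b
SameHead-sym ⟨⟩      = ⟨⟩

SameHead-trans : SameHead α β → SameHead β γ → SameHead α γ
SameHead-trans var     var     = var
SameHead-trans (a ∨ b) (c ∨ d) = ≈-trans a c ∨ ≈-trans b d
SameHead-trans ⟨⟩      ⟨⟩      = ⟨⟩

SameHead-refl : (α : Formula 𝒫) → SameHead (strip α) (strip α)
SameHead-refl (var _)   = var
SameHead-refl (∼ α)     = SameHead-refl α
SameHead-refl (_ ∨ _)   = ≈-refl ∨ ≈-refl
SameHead-refl (⟨ _ ⟩ _) = ⟨⟩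

≈⇒SameHead : α ≈ β → SameHead (strip α) (strip β)
≈⇒SameHead {α = α} ≈-refl  = SameHead-refl α
≈⇒SameHead (≈-sym p)       = SameHead-sym (≈⇒SameHead p)
≈⇒SameHead (≈-trans p q)   = SameHead-trans (≈⇒SameHead p) (≈⇒SameHead q)
≈⇒SameHead (∼-cong p)      = ≈⇒SameHead p
≈⇒SameHead (∨-cong p q)    = p ∨ q
≈⇒SameHead (⟨⟩-cong p)     = ⟨⟩
≈⇒SameHead {β = β} ¬¬≈     = SameHead-refl β
≈⇒SameHead ¬⟨⟩≈[]¬         = ⟨⟩

strip-∨ : ∀ (γ : Formula 𝒫) {α β} → SameHead (α ∨ β) (strip γ) →
          (∃[ α′ ] α′ ∈ˡ subformulas γ × α ≈ α′) × (∃[ β′ ] β′ ∈ˡ subformulas γ × β ≈ β′)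
strip-∨ (∼ γ) h with (α′ , α∈ , α≈) , (β′ , β∈ , β≈) ← strip-∨ γ h =
  (α′ , there α∈ , α≈) , (β′ , there β∈ , β≈)
strip-∨ (γ ∨ δ) (α≈ ∨ β≈) =
  (γ , there (∈-++⁺ˡ (∈-subformulas-refl γ)) , α≈) ,
  (δ , there (∈-++⁺ʳ (subformulas γ) (∈-subformulas-refl δ)) , β≈)

Cl-≈ : α ≈ β → α ∈ Cl φ → β ∈ Cl φ
Cl-≈ α≈β (γ , γ∈ , α≈) = γ , γ∈ , ⊎-map (≈-trans (≈-sym α≈β)) (≈-trans (≈-sym α≈β)) α≈

Cl⁺-≈ : α ≈ β → α ∈ Cl⁺ φ → β ∈ Cl⁺ φ
Cl⁺-≈ {φ = φ} α≈β (inj₁ α∈) = inj₁ (Cl-≈ {φ = φ} α≈β α∈)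
Cl⁺-≈ α≈β (inj₂ (R , γ , γ∈ , α≈)) =
  inj₂ (R , γ , γ∈ , ⊎-map (≈-trans (≈-sym α≈β)) (≈-trans (≈-sym α≈β)) α≈)

∼-flip : α ≈ β ⊎ α ≈ ∼ β → ∼ α ≈ β ⊎ ∼ α ≈ ∼ β
∼-flip (inj₁ α≈β)  = inj₂ (∼-cong α≈β)
∼-flip (inj₂ α≈∼β) = inj₁ (≈-trans (∼-cong α≈∼β) ¬¬≈)

∼-Cl : α ∈ Cl φ → (∼ α) ∈ Cl φ
∼-Cl (γ , γ∈ , α≈) = γ , γ∈ , ∼-flip α≈

∼-Cl⁺ : α ∈ Cl⁺ φ → (∼ α) ∈ Cl⁺ φ
∼-Cl⁺ {φ = φ} (inj₁ α∈)           = inj₁ (∼-Cl {φ = φ} α∈)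
∼-Cl⁺ (inj₂ (R , γ , γ∈ , α≈)) = inj₂ (R , γ , γ∈ , ∼-flip α≈)

⟨⟩-Cl⁺ : ∀ R → α ∈ Cl φ → (⟨ R ⟩ α) ∈ Cl⁺ φ
⟨⟩-Cl⁺ R α∈ = inj₂ (R , _ , α∈ , inj₁ ≈-refl)

subformula-Cl : α ∈ˡ subformulas φ → α ∈ Cl φ
subformula-Cl α∈ = _ , α∈ , inj₁ ≈-refl

-- The head under the negations is invariant under `≈`. This excludes the modal members of `Cl⁺ φ`
-- and leaves a subformula that is a disjunction under its negations, whose two sides are
-- subformulas again.
∨-Cl⁺⁻ : (α ∨ β) ∈ Cl⁺ φ → α ∈ Cl⁺ φ × β ∈ Cl⁺ φ
∨-Cl⁺⁻ {φ = φ} (inj₁ (γ , γ∈ , p))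
  with (α′ , α∈ , α≈) , (β′ , β∈ , β≈) ← strip-∨ γ ([ ≈⇒SameHead , ≈⇒SameHead ]′ p) =
  inj₁ (α′ , ∈-subformulas-trans α∈ γ∈ , inj₁ α≈) ,
  inj₁ (β′ , ∈-subformulas-trans β∈ γ∈ , inj₁ β≈)
∨-Cl⁺⁻ (inj₂ (R , γ , γ∈ , inj₁ p)) with () ← ≈⇒SameHead p
∨-Cl⁺⁻ (inj₂ (R , γ , γ∈ , inj₂ p)) with () ← ≈⇒SameHead p

-- From models to compass structures

module _ (em : ExcludedMiddle 0ℓ) (𝓢 : InfiniteIntervalStructure 𝒫) where

  ⊨-≈ : α ≈ β → ∀ {I} → (𝓢 , I ⊨ α → 𝓢 , I ⊨ β) × (𝓢 , I ⊨ β → 𝓢 , I ⊨ α)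
  ⊨-≈ ≈-refl        = id , id
  ⊨-≈ (≈-sym p)     = proj₂ (⊨-≈ p) , proj₁ (⊨-≈ p)
  ⊨-≈ (≈-trans p q) = proj₁ (⊨-≈ q) ∘ proj₁ (⊨-≈ p) , proj₂ (⊨-≈ p) ∘ proj₂ (⊨-≈ q)
  ⊨-≈ (∼-cong p)    = (_∘ proj₂ (⊨-≈ p)) , (_∘ proj₁ (⊨-≈ p))
  ⊨-≈ (∨-cong p q)  = ⊎-map (proj₁ (⊨-≈ p)) (proj₁ (⊨-≈ q)) , ⊎-map (proj₂ (⊨-≈ p)) (proj₂ (⊨-≈ q))
  ⊨-≈ (⟨⟩-cong p)   = map₂ (map₂ (proj₁ (⊨-≈ p))) , map₂ (map₂ (proj₂ (⊨-≈ p)))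
  ⊨-≈ ¬¬≈           = em⇒dne em , λ a ¬a → ¬a a
  ⊨-≈ ¬⟨⟩≈[]¬       = (λ ¬a (J , r , ¬¬a) → ¬a (J , r , em⇒dne em ¬¬a)) ,
                      (λ ¬a (J , r , a) → ¬a (J , r , λ n → n a))

  module _ (φ : Formula 𝒫) where

    theory : Point → Pred (Formula 𝒫) 0ℓ
    theory p α = α ∈ Cl⁺ φ × 𝓢 , p ⊨ α

    theory-atom : ∀ p → IsAtom φ (theory p)
    theory-atom p = record
      { respects-≈  = λ α≈β (α∈ , a) → Cl⁺-≈ {φ = φ} α≈β α∈ , proj₁ (⊨-≈ α≈β) a
      ; nonempty    = satisfiable
      ; F⊆Cl⁺       = proj₁
      ; negation    = λ α∈ → mk⇔
          (λ (_ , a) (_ , ¬a) → ¬a a)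
          (λ ¬∼α → α∈ , em⇒dne em (λ ¬a → ¬∼α (∼-Cl⁺ {φ = φ} α∈ , ¬a)))
      ; disjunction = λ α∨β∈ → mk⇔
          (λ { (_ , inj₁ a) → inj₁ (proj₁ (∨-Cl⁺⁻ {φ = φ} α∨β∈) , a)
             ; (_ , inj₂ b) → inj₂ (proj₂ (∨-Cl⁺⁻ {φ = φ} α∨β∈) , b) })
          [ (λ (_ , a) → α∨β∈ , inj₁ a) , (λ (_ , b) → α∨β∈ , inj₂ b) ]′
      }
      where
      φ∈ : φ ∈ Cl φ
      φ∈ = subformula-Cl (∈-subformulas-refl φ)

      satisfiable : Satisfiable (theory p)
      satisfiable with em {𝓢 , p ⊨ φ}
      ... | yes a = φ , inj₁ φ∈ , a
      ... | no ¬a = ∼ φ , inj₁ (∼-Cl {φ = φ} φ∈) , ¬a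

    private
      req : ∀ R p {α} → α ∈ Cl φ → (𝓢 , p ⊨ (⟨ R ⟩ α)) → Req φ R (theory p) α
      req R p α∈ a = α∈ , ⟨⟩-Cl⁺ {φ = φ} R α∈ , a

    -- Every interval that `p` meets begins where `q` does. Comparing right endpoints makes it `q`
    -- itself, a `B`-successor of `q` or a `B̄`-successor of `q`.
    theory-A : ∀ {p q} → Rel⟦ A ⟧ p q → _⇝A_ φ (theory p) (theory q)
    theory-A {p} {q} refl = to , from
      where
      to : ∀ {α} → Req φ A (theory p) α → _
      to (α∈ , _ , J@([ _ , w ]⟨ _ ⟩) , refl , a) with <-cmp w (right q)
      ... | tri< w<z _ _ = inj₂ (inj₁ (req B q α∈ (J , (refl , w<z) , a)))
      ... | tri≈ _ refl _ = inj₁ (α∈ , inj₁ α∈ , a)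
      ... | tri> _ _ z<w = inj₂ (inj₂ (req B̄ q α∈ (J , (refl , z<w) , a)))

      from : ∀ {α} → _ → Req φ A (theory p) α
      from (inj₁ (α∈ , _ , a))                        = req A p α∈ (q , refl , a)
      from (inj₂ (inj₁ (α∈ , _ , J , (refl , _) , a))) = req A p α∈ (J , refl , a)
      from (inj₂ (inj₂ (α∈ , _ , J , (refl , _) , a))) = req A p α∈ (J , refl , a)

    theory-B : ∀ {p q} → Rel⟦ B ⟧ p q → _⇝B_ φ (theory p) (theory q)
    theory-B {p} {q} (refl , z<y) = B̄⁺ , B̄⁻ , B⁺ , B⁻
      where
      B̄⁺ : ∀ {α} → _ → Req φ B̄ (theory q) α
      B̄⁺ (inj₁ (α∈ , _ , a))                        = req B̄ q α∈ (p , (refl , z<y) , a)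
      B̄⁺ (inj₂ (α∈ , _ , J , (refl , y<w) , a))     = req B̄ q α∈ (J , (refl , <-trans z<y y<w) , a)

      B̄⁻ : ∀ {α} → Req φ B̄ (theory q) α → _
      B̄⁻ (α∈ , _ , J@([ _ , w ]⟨ _ ⟩) , (refl , _) , a) with <-cmp w (right p)
      ... | tri< w<y _ _ = inj₂ (inj₂ (req B p α∈ (J , (refl , w<y) , a)))
      ... | tri≈ _ refl _ = inj₁ (α∈ , inj₁ α∈ , a)
      ... | tri> _ _ y<w = inj₂ (inj₁ (req B̄ p α∈ (J , (refl , y<w) , a)))

      B⁺ : ∀ {α} → _ → Req φ B (theory p) α
      B⁺ (inj₁ (α∈ , _ , a))                        = req B p α∈ (q , (refl , z<y) , a)
      B⁺ (inj₂ (α∈ , _ , J , (refl , w<z) , a))     = req B p α∈ (J , (refl , <-trans w<z z<y) , a)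

      B⁻ : ∀ {α} → Req φ B (theory p) α → _
      B⁻ (α∈ , _ , J@([ _ , w ]⟨ _ ⟩) , (refl , _) , a) with <-cmp w (right q)
      ... | tri< w<z _ _ = inj₂ (inj₁ (req B q α∈ (J , (refl , w<z) , a)))
      ... | tri≈ _ refl _ = inj₁ (α∈ , inj₁ α∈ , a)
      ... | tri> _ _ z<w = inj₂ (inj₂ (req B̄ q α∈ (J , (refl , z<w) , a)))

    canonical : InfiniteCompassStructure φ
    canonical = record
      { 𝓛            = theory
      ; atom         = theory-atom
      ; consistencyA = λ {p} {q} → theory-A {p} {q}
      ; consistencyB = λ {p} {q} → theory-B {p} {q}
      ; fulfillment  = λ { p R (α∈ , _ , q , r , a) → q , r , α∈ , inj₁ α∈ , a }
      }

-- From compass structures to models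

module _ (em : ExcludedMiddle 0ℓ) {φ : Formula 𝒫} (𝓒 : InfiniteCompassStructure φ) where

  intervals : InfiniteIntervalStructure 𝒫
  intervals = record { σ = λ p v → 𝓛 𝓒 p (var v) }

  -- For modal formulas, consistency carries a witness back to a request, with `B̄` handled as `B`
  -- read backwards, and fulfillment turns a request into a witness.
  ⊨⇔∈𝓛 : ∀ ψ → ψ ∈ˡ subformulas φ → ∀ {p} →
         (intervals , p ⊨ ψ → 𝓛 𝓒 p ψ) × (𝓛 𝓒 p ψ → intervals , p ⊨ ψ)
  ⊨⇔∈𝓛 (var v) ψ∈ = id , id
  ⊨⇔∈𝓛 (∼ ψ) ∼ψ∈ {p} =
    (λ ¬a → em⇒dne em (λ ∼ψ∉ → ¬a (proj₂ ih (Equivalence.from neg ∼ψ∉)))) ,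
    (λ ∼ψ∈F a → Equivalence.to neg (proj₁ ih a) ∼ψ∈F)
    where
    ψ∈ : ψ ∈ˡ subformulas φ
    ψ∈ = ∈-subformulas-trans (there (∈-subformulas-refl ψ)) ∼ψ∈
    ih = ⊨⇔∈𝓛 ψ ψ∈ {p}
    neg = IsAtom.negation (atom 𝓒 p) (inj₁ (subformula-Cl ψ∈))
  ⊨⇔∈𝓛 (α ∨ β) ∨∈ {p} =
    Equivalence.from dis ∘ ⊎-map (proj₁ ihα) (proj₁ ihβ) ,
    ⊎-map (proj₂ ihα) (proj₂ ihβ) ∘ Equivalence.to dis
    where
    ihα = ⊨⇔∈𝓛 α (∈-subformulas-trans (there (∈-++⁺ˡ (∈-subformulas-refl α))) ∨∈) {p}
    ihβ = ⊨⇔∈𝓛 β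
      (∈-subformulas-trans (there (∈-++⁺ʳ (subformulas α) (∈-subformulas-refl β))) ∨∈) {p}
    dis = IsAtom.disjunction (atom 𝓒 p) (inj₁ (subformula-Cl ∨∈))
  ⊨⇔∈𝓛 (⟨ R ⟩ ψ) ⟨⟩∈ {p} =
    (λ (q , r , a) → request R r (ψ∈Cl , proj₁ (⊨⇔∈𝓛 ψ ψ∈) a)) ,
    (λ ⟨⟩∈F → let q , r , _ , a = fulfillment 𝓒 p R (ψ∈Cl , ⟨⟩∈F)
              in q , r , proj₂ (⊨⇔∈𝓛 ψ ψ∈) a)
    where
    ψ∈ : ψ ∈ˡ subformulas φ
    ψ∈ = ∈-subformulas-trans (there (∈-subformulas-refl ψ)) ⟨⟩∈
    ψ∈Cl : ψ ∈ Cl φ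
    ψ∈Cl = subformula-Cl ψ∈

    request : ∀ R {q} → Rel⟦ R ⟧ p q → obs φ (𝓛 𝓒 q) ψ → 𝓛 𝓒 p (⟨ R ⟩ ψ)
    request A r a = proj₂ (proj₂ (consistencyA 𝓒 r) (inj₁ a))
    request B r a = proj₂ (proj₁ (proj₂ (proj₂ (consistencyB 𝓒 r))) (inj₁ a))
    request B̄ (x≡ , y<w) a = proj₂ (proj₁ (consistencyB 𝓒 (sym x≡ , y<w)) (inj₁ a))

  features⇒satisfies : 𝓒 Features φ → intervals Satisfies φ
  features⇒satisfies (p , φ∈) = p , proj₂ (⊨⇔∈𝓛 φ (∈-subformulas-refl φ)) φ∈

-- The proof stored in an interval is irrelevant; deciding the inequality makes it usable again.
left<right′ : ∀ I → left I < right I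
left<right′ [ x , y ]⟨ x<y ⟩ = recompute (x <? y) x<y

length-cartesianProduct : ∀ {X Y : Set} (xs : List X) (ys : List Y) →
                          length (cartesianProduct xs ys) ≡ length xs * length ys
length-cartesianProduct []       ys = refl
length-cartesianProduct (x ∷ xs) ys = trans (length-++ (map (x ,_) ys))
  (cong₂ _+_ (length-map (x ,_) ys) (length-cartesianProduct xs ys))

-- Letters copied from the rows of a model

module Contraction
  (em : ExcludedMiddle 0ℓ) {𝒫 : Set} (φ : Formula 𝒫)
  (𝓢 : InfiniteIntervalStructure 𝒫) (x₀ : ℕ)
  {m : ℕ} (code : Point → Fin m) (objectives : List (Formula 𝒫))
  (sub⇒objective : ∀ {α} → α ∈ˡ subformulas φ → α ∈ˡ objectives)
  (∼sub⇒objective : ∀ {α} → α ∈ˡ subformulas φ → ∼ α ∈ˡ objectives)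
  (determined : ∀ {α} → α ∈ˡ objectives →
                ∀ {p q} → code p ≡ code q → 𝓢 , p ⊨ α → 𝓢 , q ⊨ α)
  (⟨⟩-determined : ∀ R {α} → α ∈ˡ objectives →
                   ∀ {p q} → code p ≡ code q → 𝓢 , p ⊨ ⟨ R ⟩ α → 𝓢 , q ⊨ ⟨ R ⟩ α)
  where

  Code : Set
  Code = Fin m

  infix 4 _⊩_

  -- One interval of 𝓢 with the code suffices. For objectives and for modalities applied to them,
  -- `determined` and `⟨⟩-determined` extend the truth to all intervals with that code.
  _⊩_ : Code → Formula 𝒫 → Set
  c ⊩ α = ∃[ p ] code p ≡ c × (𝓢 , p ⊨ α)

  ⊩⇒⊨ : ∀ {c α q} → α ∈ˡ objectives → code q ≡ c → c ⊩ α → 𝓢 , q ⊨ α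
  ⊩⇒⊨ α∈ refl (p , eq , a) = determined α∈ eq a

  ⊩⟨⟩⇒⊨ : ∀ R {c α q} → α ∈ˡ objectives → code q ≡ c → c ⊩ ⟨ R ⟩ α → 𝓢 , q ⊨ ⟨ R ⟩ α
  ⊩⟨⟩⇒⊨ R α∈ refl (p , eq , a) = ⟨⟩-determined R α∈ eq a

  -- δ acts on the columns that are already open; ν labels the new one.
  record Letter : Set where
    field
      δ : Code → Code
      ν : Code
  open Letter public

  image? : ∀ (T : Subset m) l b → Dec (b ≡ ν l ⊎ ∃[ a ] a ∈ˢ T × b ≡ δ l a)
  image? T l b = (b ≟ᶠ ν l) ⊎-dec any? (λ a → (a ∈? T) ×-dec (b ≟ᶠ δ l a))

  infixl 7 _·_
  _·_ : Subset m → Letter → Subset m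
  T · l = ⟪ image? T l ⟫

  ν∈· : ∀ {T} l → ν l ∈ˢ T · l
  ν∈· {T} l = ∈⟪⟫⁺ (image? T l) (inj₁ refl)

  δ∈· : ∀ {T} l {a} → a ∈ˢ T → δ l a ∈ˢ T · l
  δ∈· {T} l a∈ = ∈⟪⟫⁺ (image? T l) (inj₂ (_ , a∈ , refl))

  ∈·⁻ : ∀ {T} l {b} → b ∈ˢ T · l → b ≡ ν l ⊎ ∃[ a ] a ∈ˢ T × b ≡ δ l a
  ∈·⁻ {T} l = ∈⟪⟫⁻ (image? T l)

  Present : ℕ → Code → Set
  Present s a = ∃[ x ] Σ[ x<s ∈ x < s ] code [ x , s ]⟨ x<s ⟩ ≡ a

  Move : ℕ → Code → Code → Set
  Move s a b = ∃[ x ] Σ[ x<s ∈ x < s ]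
    code [ x , s ]⟨ x<s ⟩ ≡ a × code [ x , suc s ]⟨ m<n⇒m<1+n x<s ⟩ ≡ b

  -- The empty row must be continued by row x₀ of 𝓢, so that column 0
  -- starts with the code of [x₀ , x₀ + 1] and keeps satisfying φ.
  Anchored : Subset m → ℕ → Set
  Anchored T s = Nonempty T ⊎ s ≡ x₀

  Realises : ℕ → Subset m → Set
  Realises s T = Anchored T s × (∀ {a} → a ∈ˢ T → Present s a)

  -- The column of 𝓢 behind a move may vary with the code, but a single row `s` serves all moves and
  -- the new column. This ties the right endpoint of an old column to the column opened there, as
  -- `⟨A⟩` requires.
  Valid : Subset m → Letter → Set
  Valid T l = ∃[ s ] Anchored T s × ν l ≡ code [ s , suc s ]⟨ n<1+n s ⟩ ×
                     (∀ {a} → a ∈ˢ T → Move s a (δ l a))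

  open Automaton _·_ Valid

  track : Code → List Letter → Code
  track = foldl (λ c l → δ l c)

  -- Row `s + 1` contains the targets of all moves out of row `s`. Hence sets reached by runs are
  -- again found in rows of 𝓢, from which further letters can be copied.
  Valid⇒Realises : ∀ {T l} → Valid T l → ∃[ s ] Realises s (T · l)
  Valid⇒Realises {T} {l} (s , _ , ν≡ , move) = suc s , inj₁ (ν l , ν∈· {T} l) , present
    where
    present : ∀ {b} → b ∈ˢ T · l → Present (suc s) b
    present b∈ with ∈·⁻ {T} l b∈
    ... | inj₁ refl = s , n<1+n s , sym ν≡
    ... | inj₂ (a , a∈ , refl) with x , x<s , _ , eq ← move a∈ = x , m<n⇒m<1+n x<s , eq

  Run⇒Realises : ∀ {T ls} → ∃[ s ] Realises s T → Run T ls → ∃[ s ] Realises s (run T ls)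
  Run⇒Realises r []       = r
  Run⇒Realises r (v ∷ vs) = Run⇒Realises (Valid⇒Realises v) vs

  ∈-track : ∀ {T b} ls → b ∈ˢ T → track b ls ∈ˢ run T ls
  ∈-track []           b∈ = b∈
  ∈-track {T} (l ∷ ls) b∈ = ∈-track ls (δ∈· {T} l b∈)

  module _ (s : ℕ) (select : ∀ {a} → Present s a → Present s a) where

    -- Codes that do not occur in row s get a junk image.
    image : ∀ {a} → Dec (Present s a) → Code
    image     (yes o) with x , x<s , _ ← select o = code [ x , suc s ]⟨ m<n⇒m<1+n x<s ⟩
    image {a} (no _)  = a

    letterAt : Letter
    letterAt = record
      { δ = λ a → image {a} em
      ; ν = code [ s , suc s ]⟨ n<1+n s ⟩
      }

    letterAt-valid : ∀ {T} → Realises s T → Valid T letterAt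
    letterAt-valid {T} (anchored , present) = s , anchored , refl , move
      where
      move : ∀ {a} → a ∈ˢ T → Move s a (image {a} em)
      move {a} a∈ with em {Present s a}
      ... | no absent = contradiction (present a∈) absent
      ... | yes o with x , x<s , eq ← select o = x , x<s , eq , refl

  follow : ∀ {s h} → h < s → ∀ {a} → Present s a → Present s a
  follow {s} {h} h<s {a} o with code [ h , s ]⟨ h<s ⟩ ≟ᶠ a
  ... | yes eq = h , h<s , eq
  ... | no _   = o

  follow-δ : ∀ {s h} (h<s : h < s) →
             δ (letterAt s (follow h<s)) (code [ h , s ]⟨ h<s ⟩) ≡
             code [ h , suc s ]⟨ m<n⇒m<1+n h<s ⟩
  follow-δ {s} {h} h<s with em {Present s (code [ h , s ]⟨ h<s ⟩)}
  ... | no absent = contradiction (h , h<s , refl) absent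
  ... | yes o with code [ h , s ]⟨ h<s ⟩ ≟ᶠ code [ h , s ]⟨ h<s ⟩
  ...   | yes _  = refl
  ...   | no neq = contradiction refl neq

  Realises-letterAt : ∀ {s T} (select : ∀ {a} → Present s a → Present s a) → Realises s T →
                      Realises (suc s) (T · letterAt s select)
  Realises-letterAt {s} select r = proj₂ (Valid⇒Realises (letterAt-valid s select r))

  -- Letters act on codes, so columns with equal codes merge; select
  -- decides which of them is copied, and here it is always column h.
  followColumn : ∀ d {s h T} (h<s : h < s) → Realises s T →
                 ∃[ ls ] Run T ls × length ls ≡ d ×
                         (∀ .(p : h < d + s) → track (code [ h , s ]⟨ h<s ⟩) ls ≡ code [ h , d + s ]⟨ p ⟩)
  followColumn zero h<s r = [] , [] , refl , λ p → refl
  followColumn (suc d) {s} {h} h<s r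
    with ls , rs , len , end ← followColumn d (m<n⇒m<1+n h<s) (Realises-letterAt (follow h<s) r)
    = letterAt s (follow h<s) ∷ ls , letterAt-valid s (follow h<s) r ∷ rs , cong suc len ,
      end′
    where
    end′ : ∀ .(p : h < suc d + s) →
           track (δ (letterAt s (follow h<s)) (code [ h , s ]⟨ h<s ⟩)) ls ≡ code [ h , suc d + s ]⟨ p ⟩
    end′ rewrite follow-δ h<s | sym (+-suc d s) = end

  -- Persistence and fulfilment of `⟨B̄⟩`-requests

  -- The witness in 𝓢 ends beyond row `s`. If it ends at `s + 1` it is the interval moved to;
  -- otherwise it still lies ahead. So a valid letter may postpone a request but never lose it.
  persist : ∀ {T l a α} → Valid T l → a ∈ˢ T → α ∈ˡ objectives → a ⊩ ⟨ B̄ ⟩ α →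
            δ l a ⊩ α ⊎ δ l a ⊩ ⟨ B̄ ⟩ α
  persist (s , _ , _ , move) a∈ α∈ req
    with x , x<s , a≡ , δa≡ ← move a∈
    with J@([ _ , w ]⟨ _ ⟩) , (refl , s<w) , sat ← ⊩⟨⟩⇒⊨ B̄ α∈ a≡ req
    with m≤n⇒m<n∨m≡n s<w
  ... | inj₁ 1+s<w = inj₂ (_ , δa≡ , J , (refl , 1+s<w) , sat)
  ... | inj₂ refl  = inj₁ (_ , δa≡ , sat)

  -- The code before the first letter does not count, since `B̄` looks strictly upwards.
  Fulfils : List Letter → Code → Formula 𝒫 → Set
  Fulfils []       b α = Empty.⊥
  Fulfils (l ∷ ls) b α = δ l b ⊩ α ⊎ Fulfils ls (δ l b) α

  Fulfils-++ˡ : ∀ ls {ls′ b α} → Fulfils ls b α → Fulfils (ls ++ ls′) b α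
  Fulfils-++ˡ (l ∷ ls) (inj₁ a) = inj₁ a
  Fulfils-++ˡ (l ∷ ls) (inj₂ f) = inj₂ (Fulfils-++ˡ ls f)

  Fulfils-++ʳ : ∀ ls {ls′ b α} → Fulfils ls′ (track b ls) α → Fulfils (ls ++ ls′) b α
  Fulfils-++ʳ []       f = f
  Fulfils-++ʳ (l ∷ ls) f = inj₂ (Fulfils-++ʳ ls f)

  Fulfils-end : ∀ l ls {b α} → track b (l ∷ ls) ⊩ α → Fulfils (l ∷ ls) b α
  Fulfils-end l []        a = inj₁ a
  Fulfils-end l (l′ ∷ ls) a = inj₂ (Fulfils-end l′ ls a)

  persist* : ∀ {T ls b α} → Run T ls → b ∈ˢ T → α ∈ˡ objectives → b ⊩ ⟨ B̄ ⟩ α →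
             Fulfils ls b α ⊎ track b ls ⊩ ⟨ B̄ ⟩ α
  persist* [] b∈ α∈ req = inj₂ req
  persist* {T} {l ∷ _} (v ∷ r) b∈ α∈ req with persist v b∈ α∈ req
  ... | inj₁ a    = inj₁ (inj₁ a)
  ... | inj₂ req′ with persist* r (δ∈· {T} l b∈) α∈ req′
  ...   | inj₁ f    = inj₁ (inj₂ f)
  ...   | inj₂ req″ = inj₂ req″

  -- The second component of a state is the code of one distinguished column, so shortening a word
  -- also preserves where that column ends.
  module Tracked = Automaton {X = Subset m × Code} (λ (T , c) l → T · l , δ l c) (λ (T , c) → Valid T)

  Tracked-run : ∀ {T c} ls → Tracked.run (T , c) ls ≡ (run T ls , track c ls)
  Tracked-run []       = refl
  Tracked-run (l ∷ ls) = Tracked-run ls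

  Run⇒Tracked : ∀ {T c ls} → Run T ls → Tracked.Run (T , c) ls
  Run⇒Tracked []      = Tracked.[]
  Run⇒Tracked (v ∷ r) = v Tracked.∷ Run⇒Tracked r

  Tracked⇒Run : ∀ {T c ls} → Tracked.Run (T , c) ls → Run T ls
  Tracked⇒Run Tracked.[]        = []
  Tracked⇒Run (v Tracked.∷ r) = v ∷ Tracked⇒Run r

  encode² : Subset m × Code → Fin (2 ^ m * m)
  encode² (T , c) = combine (encode T) c

  encode²-injective : Injective _≡_ _≡_ encode²
  encode²-injective {T , c} {U , d} eq with p , q ← combine-injective (encode T) c (encode U) d eq =
    cong₂ _,_ (encode-injective {u = T} {U} p) q

  -- In a row of 𝓢 realising `T`, some column `h` has code `b`, and the request has a witness
  -- `[h , w]`. Following column `h` up to row `w` ends in the code of that witness, which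
  -- shortening with a tracked code retains.
  fulfilOne : ∀ {T b α} → ∃[ s ] Realises s T → b ∈ˢ T → α ∈ˡ objectives → b ⊩ ⟨ B̄ ⟩ α →
              ∃[ ls ] Run T ls × length ls ≤ 2 ^ m * m × Fulfils ls b α
  fulfilOne {T} {α = α} (s , r) b∈ α∈ req
    with h , h<s , refl ← proj₂ r b∈
    with [ _ , w ]⟨ h<w ⟩ , (refl , s<w) , sat ← ⊩⟨⟩⇒⊨ B̄ α∈ refl req
    with d , refl ← m≤n⇒∃[o]m+o≡n s<w
    rewrite +-comm s d
    with followColumn (suc d) h<s r
  ... | l ∷ ls , v ∷ rs , refl , end
    -- The first letter is exempt from shortening, so that the word stays nonempty; the strict bound
    -- on the rest pays for it.
    with ls′ , rs′ , end′ , short ← Tracked.shorten encode² encode²-injective {x = T · l , δ l _} (Run⇒Tracked rs)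
    = l ∷ ls′ , v ∷ Tracked⇒Run rs′ , short , Fulfils-end l ls′ (_ , sym (trans track≡ (end h<w)) , sat)
    where
    track≡ = cong proj₂ (trans (sym (Tracked-run ls′)) (trans end′ (Tracked-run ls)))

  -- `f` sends a code to where the letters read so far have taken it. The list of pairs can thus
  -- stay fixed while words are appended; pairs that are not requests of `T` demand nothing.
  Obligation : Subset m → List Letter → (Code → Code) → Code × Formula 𝒫 → Set
  Obligation T ls f (b , α) = f b ∈ˢ T → f b ⊩ ⟨ B̄ ⟩ α → Fulfils ls (f b) α

  -- Each pair that is a request gets its own segment. A request served later is either met in
  -- passing by an earlier segment or still open at its end, by `persist*`.
  fulfilAll : ∀ {T} (f : Code → Code) obs → All (λ (b , α) → α ∈ˡ objectives) obs →
              ∃[ s ] Realises s T →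
              ∃[ ls ] Run T ls × length ls ≤ length obs * (2 ^ m * m) × All (Obligation T ls f) obs
  fulfilAll f [] [] r = [] , [] , z≤n , []
  fulfilAll {T} f ((b , α) ∷ obs) (α∈ ∷ obs∈) r with em {f b ∈ˢ T × f b ⊩ ⟨ B̄ ⟩ α}
  ... | no void with ls , rs , len , all ← fulfilAll f obs obs∈ r =
    ls , rs , ≤-trans len (m≤n+m _ _) , (λ b∈ req → contradiction (b∈ , req) void) ∷ all
  ... | yes (b∈ , req)
    with ls , rs , len , done ← fulfilOne r b∈ α∈ req
    with ls′ , rs′ , len′ , all ← fulfilAll (λ c → track (f c) ls) obs obs∈ (Run⇒Realises r rs)
    = ls ++ ls′ , Run-++ rs rs′ ,
      ≤-trans (≤-reflexive (length-++ ls)) (+-mono-≤ len len′) ,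
      (λ _ _ → Fulfils-++ˡ ls done) ∷ All.zipWith (λ (o∈ , o) → extend o∈ o) (obs∈ , all)
    where
    extend : ∀ {o} → proj₂ o ∈ˡ objectives →
             Obligation (run T ls) ls′ (λ c → track (f c) ls) o → Obligation T (ls ++ ls′) f o
    extend o∈ o c∈ req with persist* rs c∈ o∈ req
    ... | inj₁ f    = Fulfils-++ˡ ls f
    ... | inj₂ req′ = Fulfils-++ʳ ls (o (∈-track ls c∈) req′)

  -- The structure described by `u w w w …`

  module Unrolling
    (T* : Subset m) (u : List Letter) (l₀ : Letter) (w⁻ : List Letter)
    (u-run : Run ⊥ u) (u-end : run ⊥ u ≡ T*)
    (w-run : Run T* (l₀ ∷ w⁻)) (w-end : run T* (l₀ ∷ w⁻) ≡ T*)
    (w-fulfils : ∀ {b α} → b ∈ˢ T* → α ∈ˡ objectives → b ⊩ ⟨ B̄ ⟩ α → Fulfils (l₀ ∷ w⁻) b α)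
    where

    -- Nonempty by its form, so that `stream` can always restart it and the period is positive.
    w : List Letter
    w = l₀ ∷ w⁻

    -- stream ls is ls followed by w w w ….
    stream : List Letter → ℕ → Letter
    stream []       zero    = l₀
    stream []       (suc i) = stream w⁻ i
    stream (l ∷ _)  zero    = l
    stream (_ ∷ ls) (suc i) = stream ls i

    stream-[] : ∀ i → stream [] i ≡ stream w i
    stream-[] zero    = refl
    stream-[] (suc i) = refl

    stream-drop : ∀ ls i → stream ls (length ls + i) ≡ stream w i
    stream-drop []       i = stream-[] i
    stream-drop (l ∷ ls) i = stream-drop ls i

    letter : ℕ → Letter
    letter = stream u

    Follows : ℕ → List Letter → Set
    Follows i ls = ∀ j → letter (i + j) ≡ stream ls j

    Follows-head : ∀ {i l ls} → Follows i (l ∷ ls) → letter i ≡ l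
    Follows-head {i} f = trans (cong letter (sym (+-identityʳ i))) (f 0)

    Follows-tail : ∀ {i l ls} → Follows i (l ∷ ls) → Follows (suc i) ls
    Follows-tail {i} f j = trans (cong letter (sym (+-suc i j))) (f (suc j))

    Follows-drop : ∀ {i} ls → Follows i ls → Follows (i + length ls) w
    Follows-drop {i} ls f j = begin
      letter (i + length ls + j)    ≡⟨ cong letter (+-assoc i (length ls) j) ⟩
      letter (i + (length ls + j))  ≡⟨ f (length ls + j) ⟩
      stream ls (length ls + j)     ≡⟨ stream-drop ls j ⟩
      stream w j                    ∎
      where open ≡-Reasoning

    -- The codes found in row `y` of the new structure, as `label∈codes` and `codes⇒label` confirm;
    -- row 0 has no columns.
    codes : ℕ → Subset m
    codes zero    = ⊥
    codes (suc y) = codes y · letter y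

    codes-run : ∀ {i} ls → Follows i ls → codes (i + length ls) ≡ run (codes i) ls
    codes-run {i} []       f = cong codes (+-identityʳ i)
    codes-run {i} (l ∷ ls) f = begin
      codes (i + suc (length ls))    ≡⟨ cong codes (+-suc i (length ls)) ⟩
      codes (suc i + length ls)      ≡⟨ codes-run ls (Follows-tail f) ⟩
      run (codes i · letter i) ls    ≡⟨ cong (λ k → run (codes i · k) ls) (Follows-head f) ⟩
      run (codes i · l) ls           ∎
      where open ≡-Reasoning

    ỹ₀ ỹ : ℕ
    ỹ₀ = length u
    ỹ  = length w

    PeriodStart : ℕ → Set
    PeriodStart i = codes i ≡ T* × Follows i w

    start : PeriodStart ỹ₀
    start = trans (codes-run u (λ _ → refl)) u-end , Follows-drop u (λ _ → refl)

    restart : ∀ {i} → PeriodStart i → PeriodStart (i + ỹ)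
    restart (eq , f) = trans (codes-run w f) (trans (cong (λ T → run T w) eq) w-end) , Follows-drop w f

    laterStart : ∀ y → ∃[ i ] y ≤ i × PeriodStart i
    laterStart zero    = ỹ₀ , z≤n , start
    laterStart (suc y) with i , y≤i , s ← laterStart y =
      i + ỹ , ≤-trans (s≤s y≤i) (m<m+n i z<s) , restart s

    -- The invariant behind `valid`: the unread rest of the current copy of `u` or `w` is a run to
    -- `T*`. Once it is used up, the next copy of `w` takes over.
    Remaining : ℕ → Set
    Remaining i = ∃[ ls ] Run (codes i) ls × run (codes i) ls ≡ T* × Follows i ls

    advance : ∀ {i l ls} → Run (codes i) (l ∷ ls) → run (codes i) (l ∷ ls) ≡ T* → Follows i (l ∷ ls) →
              Valid (codes i) (letter i) × Remaining (suc i)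
    advance (v ∷ r) end f with refl ← Follows-head f = v , _ , r , end , Follows-tail f

    valid×remaining : ∀ i → Remaining i → Valid (codes i) (letter i) × Remaining (suc i)
    valid×remaining i (l ∷ ls , r , end , f) = advance r end f
    valid×remaining i ([] , [] , end , f) = advance
      (subst (λ T → Run T w) (sym end) w-run)
      (trans (cong (λ T → run T w) end) w-end)
      (λ j → trans (f j) (stream-[] j))

    remaining : ∀ i → Remaining i
    remaining zero    = u , u-run , u-end , λ _ → refl
    remaining (suc i) = proj₂ (valid×remaining i (remaining i))

    valid : ∀ i → Valid (codes i) (letter i)
    valid i = proj₁ (valid×remaining i (remaining i))

    -- Meaningless when y ≤ x.
    label : ℕ → ℕ → Code
    label x zero = ν (letter 0)
    label x (suc y) with x ≟ⁿ y
    ... | yes _ = ν (letter y)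
    ... | no  _ = δ (letter y) (label x y)

    label-base : ∀ x → label x (suc x) ≡ ν (letter x)
    label-base x with x ≟ⁿ x
    ... | yes _   = refl
    ... | no neq = contradiction refl neq

    label-step : ∀ {x y} → x < y → label x (suc y) ≡ δ (letter y) (label x y)
    label-step {x} {y} x<y with x ≟ⁿ y
    ... | yes refl = contradiction x<y (<-irrefl refl)
    ... | no _     = refl

    label∈codes : ∀ {x y} → x < y → label x y ∈ˢ codes y
    label∈codes {x} {suc y} x<1+y with m<1+n⇒m<n∨m≡n x<1+y
    ... | inj₂ refl = subst (_∈ˢ codes (suc x)) (sym (label-base x)) (ν∈· {codes x} (letter x))
    ... | inj₁ x<y  =
      subst (_∈ˢ codes (suc y)) (sym (label-step x<y)) (δ∈· {codes y} (letter y) (label∈codes x<y))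

    codes⇒label : ∀ {y c} → c ∈ˢ codes y → ∃[ x ] x < y × label x y ≡ c
    codes⇒label {zero}  c∈ = contradiction c∈ ∉⊥
    codes⇒label {suc y} c∈ with ∈·⁻ {codes y} (letter y) c∈
    ... | inj₁ refl = y , n<1+n y , label-base y
    ... | inj₂ (a , a∈ , refl) with x , x<y , refl ← codes⇒label {y} a∈ =
      x , m<n⇒m<1+n x<y , label-step x<y

    base : ∀ y → ∃[ s ] code [ s , suc s ]⟨ n<1+n s ⟩ ≡ label y (suc y)
    base y with s , _ , ν≡ , _ ← valid y = s , trans (sym ν≡) (sym (label-base y))

    -- Local questions about the new structure are settled in 𝓢 through this lemma. The same `s`
    -- serves column `x` and the column opened at `y`, because both come from one valid letter.
    step : ∀ {x y} → x < y → ∃[ s ] Move s (label x y) (label x (suc y)) ×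
                                    code [ s , suc s ]⟨ n<1+n s ⟩ ≡ label y (suc y)
    step {x} {y} x<y with s , _ , ν≡ , move ← valid y =
      s , subst (Move s (label x y)) (sym (label-step x<y)) (move (label∈codes x<y)) ,
      trans (sym ν≡) (sym (label-base y))

    realised : ∀ {x y} → x < y → ∃[ q ] code q ≡ label x y
    realised x<y with _ , (_ , _ , eq , _) , _ ← step x<y = _ , eq

    -- Periodicity of labels

    -- From any row on, a column is determined by its code there and the letters still to come. Both
    -- periodicity conditions rest on this.
    label-shift : ∀ {x x′} y z → x < y → x′ < z → label x y ≡ label x′ z →
                  (∀ k → letter (y + k) ≡ letter (z + k)) →
                  ∀ k → label x (y + k) ≡ label x′ (z + k)
    label-shift y z x<y x′<z eq per zero
      rewrite +-identityʳ y | +-identityʳ z = eq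
    label-shift {x} {x′} y z x<y x′<z eq per (suc k) rewrite +-suc y k | +-suc z k = begin
      label x (suc (y + k))                      ≡⟨ label-step (m≤n⇒m≤n+o k x<y) ⟩
      δ (letter (y + k)) (label x (y + k))
        ≡⟨ cong₂ δ (per k) (label-shift y z x<y x′<z eq per k) ⟩
      δ (letter (z + k)) (label x′ (z + k))      ≡⟨ label-step (m≤n⇒m≤n+o k x′<z) ⟨
      label x′ (suc (z + k))                     ∎
      where open ≡-Reasoning

    letter-periodic : ∀ k → letter (ỹ₀ + ỹ + k) ≡ letter (ỹ₀ + k)
    letter-periodic k = trans (proj₂ (restart start) k) (sym (proj₂ start k))

    letter-periodic′ : ∀ {i} → ỹ₀ ≤ i → letter (i + ỹ) ≡ letter i
    letter-periodic′ {i} ỹ₀≤i with k , refl ← m≤n⇒∃[o]m+o≡n ỹ₀≤i = begin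
      letter (ỹ₀ + k + ỹ)    ≡⟨ cong letter (+-assoc ỹ₀ k ỹ) ⟩
      letter (ỹ₀ + (k + ỹ))  ≡⟨ cong (λ i → letter (ỹ₀ + i)) (+-comm k ỹ) ⟩
      letter (ỹ₀ + (ỹ + k))  ≡⟨ cong letter (+-assoc ỹ₀ ỹ k) ⟨
      letter (ỹ₀ + ỹ + k)    ≡⟨ letter-periodic k ⟩
      letter (ỹ₀ + k)        ∎
      where open ≡-Reasoning

    label-periodic : ∀ {x y} → ỹ₀ ≤ x → x < y → label (x + ỹ) (y + ỹ) ≡ label x y
    label-periodic {x} {y} ỹ₀≤x x<y with k , refl ← m≤n⇒∃[o]m+o≡n x<y = begin
      label (x + ỹ) (suc x + k + ỹ)    ≡⟨ cong (label (x + ỹ)) (shuffle (suc x) k ỹ) ⟩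
      label (x + ỹ) (suc (x + ỹ) + k)
        ≡⟨ label-shift (suc (x + ỹ)) (suc x) (n<1+n _) (n<1+n _) bases per k ⟩
      label x (suc x + k)              ∎
      where
      open ≡-Reasoning
      shuffle : ∀ a b c → a + b + c ≡ a + c + b
      shuffle a b c = trans (+-assoc a b c) (trans (cong (a +_) (+-comm b c)) (sym (+-assoc a c b)))

      bases : label (x + ỹ) (suc (x + ỹ)) ≡ label x (suc x)
      bases = trans (label-base (x + ỹ)) (trans (cong ν (letter-periodic′ ỹ₀≤x)) (sym (label-base x)))

      per : ∀ k → letter (suc x + ỹ + k) ≡ letter (suc x + k)
      per k = trans (cong letter (shuffle (suc x) ỹ k))
                    (letter-periodic′ (≤-trans ỹ₀≤x (≤-trans (n≤1+n x) (m≤m+n (suc x) k))))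

    -- Rows `ỹ₀` and `ỹ₀ + ỹ` both start a copy of `w` and both carry exactly the codes of `T*`. The
    -- column found here is the value of the binding at `x`.
    bound : ∀ {x} → x < ỹ₀ + ỹ → ∃[ x′ ] x′ < ỹ₀ × label x′ ỹ₀ ≡ label x (ỹ₀ + ỹ)
    bound {x} x< = codes⇒label
      (subst (label x (ỹ₀ + ỹ) ∈ˢ_) (trans (proj₁ (restart start)) (sym (proj₁ start)))
        (label∈codes x<))

    label-bound : ∀ {x x′} → x < ỹ₀ + ỹ → x′ < ỹ₀ → label x′ ỹ₀ ≡ label x (ỹ₀ + ỹ) →
                  ∀ {y} → ỹ₀ + ỹ ≤ y → label x y ≡ label x′ (y ∸ ỹ)
    label-bound {x} {x′} x< x′< eq {y} y≥ with k , refl ← m≤n⇒∃[o]m+o≡n y≥ = begin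
      label x (ỹ₀ + ỹ + k)        ≡⟨ label-shift (ỹ₀ + ỹ) ỹ₀ x< x′< (sym eq) letter-periodic k ⟩
      label x′ (ỹ₀ + k)           ≡⟨ cong (label x′) (m+n∸n≡m (ỹ₀ + k) ỹ) ⟨
      label x′ (ỹ₀ + k + ỹ ∸ ỹ)
        ≡⟨ cong (λ i → label x′ (i ∸ ỹ))
             (trans (+-assoc ỹ₀ k ỹ) (trans (cong (ỹ₀ +_) (+-comm k ỹ)) (sym (+-assoc ỹ₀ ỹ k)))) ⟩
      label x′ (ỹ₀ + ỹ + k ∸ ỹ)   ∎
      where open ≡-Reasoning

    -- Soundness and fulfilment of requests along labels

    -- By `step`, the two labels are the codes of some `[h , s]` and `[h , s + 1]` in 𝓢, where the
    -- second interval and its extensions are `B̄`-successors of the first. `B-push` reads the same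
    -- pair downwards.
    B̄-pull : ∀ {α x y} → α ∈ˡ objectives → x < y →
             label x (suc y) ⊩ α ⊎ label x (suc y) ⊩ ⟨ B̄ ⟩ α → label x y ⊩ ⟨ B̄ ⟩ α
    B̄-pull α∈ x<y a with _ , (h , h<s , eq , eq′) , _ ← step x<y | a
    ... | inj₁ a = [ h , _ ]⟨ h<s ⟩ , eq , _ , (refl , n<1+n _) , ⊩⇒⊨ α∈ eq′ a
    ... | inj₂ a with J , (refl , s<w) , sat ← ⊩⟨⟩⇒⊨ B̄ α∈ eq′ a =
      [ h , _ ]⟨ h<s ⟩ , eq , J , (refl , <-trans (n<1+n _) s<w) , sat

    B-push : ∀ {α x y} → α ∈ˡ objectives → x < y →
             label x y ⊩ α ⊎ label x y ⊩ ⟨ B ⟩ α → label x (suc y) ⊩ ⟨ B ⟩ α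
    B-push α∈ x<y a with _ , (h , h<s , eq , eq′) , _ ← step x<y | a
    ... | inj₁ a = [ h , _ ]⟨ m<n⇒m<1+n h<s ⟩ , eq′ , _ , (refl , n<1+n _) , ⊩⇒⊨ α∈ eq a
    ... | inj₂ a with J , (refl , w<s) , sat ← ⊩⟨⟩⇒⊨ B α∈ eq a =
      [ h , _ ]⟨ m<n⇒m<1+n h<s ⟩ , eq′ , J , (refl , <-trans w<s (n<1+n _)) , sat

    B̄-sound : ∀ {α x y} k → α ∈ˡ objectives → x < y → label x (suc y + k) ⊩ α → label x y ⊩ ⟨ B̄ ⟩ α
    B̄-sound {y = y} zero    α∈ x<y a rewrite +-identityʳ y = B̄-pull α∈ x<y (inj₁ a)
    B̄-sound {y = y} (suc k) α∈ x<y a rewrite +-suc y k =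
      B̄-pull α∈ x<y (inj₂ (B̄-sound k α∈ (m<n⇒m<1+n x<y) a))

    B-sound : ∀ {α x y} k → α ∈ˡ objectives → x < y → label x y ⊩ α → label x (suc y + k) ⊩ ⟨ B ⟩ α
    B-sound {y = y} zero    α∈ x<y a rewrite +-identityʳ y = B-push α∈ x<y (inj₁ a)
    B-sound {y = y} (suc k) α∈ x<y a rewrite +-suc y k =
      B-push α∈ (m≤n⇒m≤n+o k (m<n⇒m<1+n x<y)) (inj₂ (B-sound k α∈ x<y a))

    -- The ⟨B⟩-request is handed down the column, at the latest to its
    -- first point, a copy of [s , s + 1], which has none.
    B-fulfil : ∀ {α x y} → α ∈ˡ objectives → x < y → label x y ⊩ ⟨ B ⟩ α →
               ∃[ z ] x < z × z < y × label x z ⊩ α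
    B-fulfil {y = suc y} α∈ x<1+y req with m<1+n⇒m<n∨m≡n x<1+y
    ... | inj₂ refl with s , eq ← base y
        with [ _ , _ ]⟨ s<w ⟩ , (refl , w<1+s) , _ ← ⊩⟨⟩⇒⊨ B α∈ eq req =
      contradiction (recompute (_ <? _) s<w) (≤⇒≯ (≤-pred w<1+s))
    ... | inj₁ x<y with _ , (h , h<s , eq , eq′) , _ ← step x<y
        with J@([ _ , w ]⟨ _ ⟩) , (refl , w<1+s) , sat ← ⊩⟨⟩⇒⊨ B α∈ eq′ req
        with m<1+n⇒m<n∨m≡n w<1+s
    ...   | inj₂ refl = y , x<y , n<1+n y , (J , eq , sat)
    ...   | inj₁ w<s with z , x<z , z<y , a ← B-fulfil α∈ x<y (_ , eq , J , (refl , w<s) , sat) =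
      z , x<z , m<n⇒m<1+n z<y , a

    Later : ℕ → ℕ → Formula 𝒫 → Set
    Later x y α = ∃[ z ] y < z × label x z ⊩ α

    delay : ∀ {α x y} k → α ∈ˡ objectives → x < y → label x y ⊩ ⟨ B̄ ⟩ α →
            Later x y α ⊎ label x (y + k) ⊩ ⟨ B̄ ⟩ α
    delay {y = y} zero α∈ x<y req rewrite +-identityʳ y = inj₂ req
    delay {α} {x} {y} (suc k) α∈ x<y req with delay k α∈ x<y req
    ... | inj₁ done = inj₁ done
    ... | inj₂ req′ rewrite +-suc y k
        with persist (valid (y + k)) (label∈codes (m≤n⇒m≤n+o k x<y)) α∈ req′
    ...   | inj₁ a    = inj₁ (suc (y + k) , s≤s (m≤m+n y k) , subst (_⊩ α) (sym (label-step (m≤n⇒m≤n+o k x<y))) a)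
    ...   | inj₂ req″ = inj₂ (subst (_⊩ ⟨ B̄ ⟩ α) (sym (label-step (m≤n⇒m≤n+o k x<y))) req″)

    Fulfils⇒Later : ∀ {α x} ls {i} → x < i → Follows i ls → Fulfils ls (label x i) α → Later x i α
    Fulfils⇒Later {α} {x} (l ∷ ls) {i} x<i f done with done
    ... | inj₁ a = suc i , n<1+n i , subst (_⊩ α) (sym next) a
      where
      next : label x (suc i) ≡ δ l (label x i)
      next = trans (label-step x<i) (cong (λ k → δ k (label x i)) (Follows-head f))
    ... | inj₂ later
      with z , i<z , a ← Fulfils⇒Later ls (m<n⇒m<1+n x<i) (Follows-tail f)
             (subst (λ c → Fulfils ls c α)
               (sym (trans (label-step x<i) (cong (λ k → δ k (label x i)) (Follows-head f)))) later)
      = z , <-trans (n<1+n i) i<z , a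

    -- The non-local condition enters here: a request not met earlier survives until the next copy
    -- of `w` starts, where the row is `T*` and `w-fulfils` applies.
    B̄-fulfil : ∀ {α x y} → α ∈ˡ objectives → x < y → label x y ⊩ ⟨ B̄ ⟩ α → Later x y α
    B̄-fulfil {x = x} {y} α∈ x<y req
      with i , y≤i , eq , follows ← laterStart y
      with k , refl ← m≤n⇒∃[o]m+o≡n y≤i
      with delay k α∈ x<y req
    ... | inj₁ done = done
    ... | inj₂ req′
      with x<i ← m≤n⇒m≤n+o k x<y
      with z , i<z , a ← Fulfils⇒Later w x<i follows
             (w-fulfils (subst (label x (y + k) ∈ˢ_) eq (label∈codes x<i)) α∈ req′)
      = z , ≤-<-trans (m≤m+n y k) i<z , a

    -- `step` puts some `[h , s]` and the interval `[s , s + 1]` of 𝓢 behind the points `(x , y)`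
    -- and `(y , y + 1)`. What `[h , s]` meets is `[s , s + 1]` or a `B̄`-successor of it, so `⟨A⟩`
    -- reduces to the first point of column `y`; `A-fulfil` uses this too.
    A-sound : ∀ {α x y} k → α ∈ˡ objectives → x < y → label y (suc y + k) ⊩ α → label x y ⊩ ⟨ A ⟩ α
    A-sound {y = y} zero α∈ x<y a rewrite +-identityʳ y
      with s , (h , h<s , eq , _) , eqᴬ ← step x<y =
      [ h , s ]⟨ h<s ⟩ , eq , _ , refl , ⊩⇒⊨ α∈ eqᴬ a
    A-sound {y = y} (suc k) α∈ x<y a rewrite +-suc y k
      with s , (h , h<s , eq , _) , eqᴬ ← step x<y
      with J , (refl , _) , sat ← ⊩⟨⟩⇒⊨ B̄ α∈ eqᴬ (B̄-sound k α∈ (n<1+n y) a) =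
      [ h , s ]⟨ h<s ⟩ , eq , J , refl , sat

    A-fulfil : ∀ {α x y} → α ∈ˡ objectives → x < y → label x y ⊩ ⟨ A ⟩ α → Later y y α
    A-fulfil {y = y} α∈ x<y req
      with s , (h , h<s , eq , _) , eqᴬ ← step x<y
      with J@([ _ , w ]⟨ s<w ⟩) , refl , sat ← ⊩⟨⟩⇒⊨ A α∈ eq req
      with m≤n⇒m<n∨m≡n (recompute (_ <? _) s<w)
    ... | inj₂ refl = suc y , n<1+n y , J , eqᴬ , sat
    ... | inj₁ 1+s<w with z , 1+y<z , a ← B̄-fulfil α∈ (n<1+n y) (_ , eqᴬ , J , (refl , 1+s<w) , sat) =
      z , <-trans (n<1+n y) 1+y<z , a

    -- Truth in the unrolled structure

    periodicStructure : InfiniteIntervalStructure 𝒫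
    periodicStructure = record { σ = λ p v → label (left p) (right p) ⊩ var v }

    Faithful : Formula 𝒫 → Set
    Faithful α = ∀ p → (periodicStructure , p ⊨ α → label (left p) (right p) ⊩ α) ×
                       (label (left p) (right p) ⊩ α → periodicStructure , p ⊨ α)

    ⟨⟩-faithful : ∀ R {α} → α ∈ˡ objectives → Faithful α → Faithful (⟨ R ⟩ α)
    ⟨⟩-faithful A {α} α∈ ih p = to , from
      where
      to : periodicStructure , p ⊨ ⟨ A ⟩ α → label (left p) (right p) ⊩ ⟨ A ⟩ α
      to (J@([ _ , z ]⟨ y<z ⟩) , refl , a) with k , refl ← m≤n⇒∃[o]m+o≡n y<z =
        A-sound k α∈ (left<right′ p) (proj₁ (ih J) a)
      from : label (left p) (right p) ⊩ ⟨ A ⟩ α → periodicStructure , p ⊨ ⟨ A ⟩ α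
      from req with z , y<z , a ← A-fulfil α∈ (left<right′ p) req =
        [ right p , z ]⟨ y<z ⟩ , refl , proj₂ (ih _) a
    ⟨⟩-faithful B {α} α∈ ih p = to , from
      where
      to : periodicStructure , p ⊨ ⟨ B ⟩ α → label (left p) (right p) ⊩ ⟨ B ⟩ α
      to (J@([ _ , _ ]⟨ _ ⟩) , (refl , z<y) , a) with k , eq ← m≤n⇒∃[o]m+o≡n z<y =
        subst (λ y → label (left p) y ⊩ ⟨ B ⟩ α) eq $ B-sound k α∈ (left<right′ J) (proj₁ (ih J) a)
      from : label (left p) (right p) ⊩ ⟨ B ⟩ α → periodicStructure , p ⊨ ⟨ B ⟩ α
      from req with z , x<z , z<y , a ← B-fulfil α∈ (left<right′ p) req =
        [ left p , z ]⟨ x<z ⟩ , (refl , z<y) , proj₂ (ih _) a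
    ⟨⟩-faithful B̄ {α} α∈ ih p = to , from
      where
      to : periodicStructure , p ⊨ ⟨ B̄ ⟩ α → label (left p) (right p) ⊩ ⟨ B̄ ⟩ α
      to (J@([ _ , z ]⟨ _ ⟩) , (refl , y<z) , a) with k , refl ← m≤n⇒∃[o]m+o≡n y<z =
        B̄-sound k α∈ (left<right′ p) (proj₁ (ih J) a)
      from : label (left p) (right p) ⊩ ⟨ B̄ ⟩ α → periodicStructure , p ⊨ ⟨ B̄ ⟩ α
      from req with z , y<z , a ← B̄-fulfil α∈ (left<right′ p) req =
        [ left p , z ]⟨ <-trans (left<right′ p) y<z ⟩ , (refl , y<z) , proj₂ (ih _) a

    -- As `⊩` is existential, a negation needs an interval of 𝓢 with the given code, which
    -- `realised` supplies. Conversely, one such interval refuting `α` suffices, since codes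
    -- determine `α`.
    ∼-faithful : ∀ {α} → α ∈ˡ subformulas φ → Faithful α → Faithful (∼ α)
    ∼-faithful α∈ ih p =
      (λ ¬a → let q , eq = realised (left<right′ p)
              in q , eq , λ a → ¬a (proj₂ (ih p) (q , eq , a))) ,
      (λ (q , eq , ¬a) a → ¬a (⊩⇒⊨ (sub⇒objective α∈) eq (proj₁ (ih p) a)))

    faithful : ∀ α → α ∈ˡ subformulas φ → Faithful α
    faithful (var v) α∈ p = id , id
    faithful (∼ α) α∈ = ∼-faithful α∈′ (faithful α α∈′)
      where α∈′ = ∈-subformulas-trans (there (∈-subformulas-refl α)) α∈
    faithful (α ∨ β) ∨∈ p =
      [ (λ a → map₂ (map₂ inj₁) (proj₁ (ihα p) a)) , (λ b → map₂ (map₂ inj₂) (proj₁ (ihβ p) b)) ]′ ,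
      λ { (q , eq , inj₁ a) → inj₁ (proj₂ (ihα p) (q , eq , a))
        ; (q , eq , inj₂ b) → inj₂ (proj₂ (ihβ p) (q , eq , b)) }
      where
      ihα = faithful α (∈-subformulas-trans (there (∈-++⁺ˡ (∈-subformulas-refl α))) ∨∈)
      ihβ = faithful β
        (∈-subformulas-trans (there (∈-++⁺ʳ (subformulas α) (∈-subformulas-refl β))) ∨∈)
    faithful (⟨ R ⟩ α) α∈ = ⟨⟩-faithful R (sub⇒objective α∈′) (faithful α α∈′)
      where α∈′ = ∈-subformulas-trans (there (∈-subformulas-refl α)) α∈

    Cl-faithful : ∀ {α} → α ∈ Cl φ → ∃[ o ] o ∈ˡ objectives × Faithful o × α ≈ o
    Cl-faithful (d , d∈ , inj₁ α≈) = d , sub⇒objective d∈ , faithful d d∈ , α≈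
    Cl-faithful (d , d∈ , inj₂ α≈) =
      ∼ d , ∼sub⇒objective d∈ , ∼-faithful d∈ (faithful d d∈) , α≈

    Cl⁺-faithful : ∀ {α} → α ∈ Cl⁺ φ → ∃[ o ] Faithful o × (α ≈ o ⊎ α ≈ ∼ o)
    Cl⁺-faithful (inj₁ (d , d∈ , α≈)) = d , faithful d d∈ , α≈
    Cl⁺-faithful (inj₂ (R , γ , γ∈ , α≈)) with o , o∈ , o-faithful , γ≈o ← Cl-faithful γ∈ =
      ⟨ R ⟩ o , ⟨⟩-faithful R o∈ o-faithful ,
      ⊎-map (λ p → ≈-trans p (⟨⟩-cong γ≈o)) (λ p → ≈-trans p (∼-cong (⟨⟩-cong γ≈o))) α≈

    -- Each member of `Cl⁺ φ` is, up to `≈`, a faithful formula or the negation of one, and truth of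
    -- a faithful formula depends on the label alone. This carries periodicity from labels to atoms.
    transfer : ∀ {p q} → label (left p) (right p) ≡ label (left q) (right q) →
               ∀ {α} → theory em periodicStructure φ p α → theory em periodicStructure φ q α
    transfer {p} {q} eq (α∈ , a) with o , o-faithful , α≈ ← Cl⁺-faithful α∈ | α≈
    ... | inj₁ α≈o = α∈ , proj₂ (⊨-≈ em periodicStructure α≈o)
      (proj₂ (o-faithful q) (subst (_⊩ o) eq (proj₁ (o-faithful p) (proj₁ (⊨-≈ em periodicStructure α≈o) a))))
    ... | inj₂ α≈∼o = α∈ , proj₂ (⊨-≈ em periodicStructure α≈∼o) λ b →
      proj₁ (⊨-≈ em periodicStructure α≈∼o) a
        (proj₂ (o-faithful p) (subst (_⊩ o) (sym eq) (proj₁ (o-faithful q) b)))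

    transfer≐ : ∀ {p q} → label (left p) (right p) ≡ label (left q) (right q) →
                theory em periodicStructure φ p ≐ theory em periodicStructure φ q
    transfer≐ {p} {q} eq = transfer {p} {q} eq , transfer {q} {p} (sym eq)

    structure : InfiniteCompassStructure φ
    structure = canonical em periodicStructure φ

    structure-periodic : Periodic structure ỹ₀ ỹ
    structure-periodic = (λ x → fromℕ< (proj₁ (proj₂ (bound (toℕ<n x))))) , record
      { ỹ>0      = z<s
      ; periodic = λ {x} {y} x≥ x<y → transfer≐ (shift x≥ x<y)
      ; binding  = λ x y≥ → transfer≐ (bind x y≥)
      }
      where
      shift : ∀ {x y} → ỹ₀ + ỹ ≤ x → x < y → label x y ≡ label (x ∸ ỹ) (y ∸ ỹ)
      shift {x} {y} x≥ x<y = begin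
        label x y                          ≡⟨ cong₂ label (m∸n+n≡m ỹ≤x) (m∸n+n≡m ỹ≤y) ⟨
        label (x ∸ ỹ + ỹ) (y ∸ ỹ + ỹ)
          ≡⟨ label-periodic (m+n≤o⇒m≤o∸n ỹ₀ x≥) (∸-monoˡ-< x<y ỹ≤x) ⟩
        label (x ∸ ỹ) (y ∸ ỹ)              ∎
        where
        open ≡-Reasoning
        ỹ≤x = m+n≤o⇒n≤o ỹ₀ x≥
        ỹ≤y = ≤-trans ỹ≤x (<⇒≤ x<y)

      bind : ∀ (x : Fin (ỹ₀ + ỹ)) {y} → ỹ₀ + ỹ ≤ y →
             label (toℕ x) y ≡ label (toℕ (fromℕ< (proj₁ (proj₂ (bound (toℕ<n x)))))) (y ∸ ỹ)
      bind x {y} y≥ with x′ , x′< , eq ← bound (toℕ<n x) =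
        trans (label-bound (toℕ<n x) x′< eq y≥) (cong (λ i → label i (y ∸ ỹ)) (sym (toℕ-fromℕ< x′<)))

    -- The interval satisfying `φ` is `[x₀ , x₀ + 1]` or an extension of it. The first point of
    -- column 0 has the code of `[x₀ , x₀ + 1]`, so it satisfies `φ` or requests it upwards.
    structure-features : ∀ {y} (x₀<y : x₀ < y) → 𝓢 , [ x₀ , y ]⟨ x₀<y ⟩ ⊨ φ → structure Features φ
    structure-features x₀<y sat = let z , 0<z , a = witness in
      [ 0 , z ]⟨ 0<z ⟩ , inj₁ (subformula-Cl (∈-subformulas-refl φ)) ,
      proj₂ (faithful φ (∈-subformulas-refl φ) _) a
      where
      φ∈ : φ ∈ˡ objectives
      φ∈ = sub⇒objective (∈-subformulas-refl φ)

      origin : code [ x₀ , suc x₀ ]⟨ n<1+n x₀ ⟩ ≡ label 0 1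
      origin with valid 0
      -- Row 0 has no codes, so its letter can only be anchored at row `x₀`.
      ... | s , inj₁ (_ , c∈) , _        = contradiction c∈ ∉⊥
      ... | s , inj₂ refl , ν≡ , _ = sym ν≡

      witness : ∃[ z ] 0 < z × label 0 z ⊩ φ
      witness with m≤n⇒m<n∨m≡n x₀<y
      ... | inj₂ refl = 1 , z<s , _ , origin , sat
      ... | inj₁ 1+x₀<y
          with z , 1<z , a ← B̄-fulfil {y = 1} φ∈ z<s (_ , origin , _ , (refl , 1+x₀<y) , sat) =
        z , <-trans z<s 1<z , a

  -- Choice of `u` and `w`

  infix 4 _≲_
  _≲_ : Subset m → Subset m → Set
  T ≲ U = ∃[ ls ] Run T ls × run T ls ≡ U

  ≲-refl : ∀ {T} → T ≲ T
  ≲-refl = [] , [] , refl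

  ≲-trans : ∀ {T U V} → T ≲ U → U ≲ V → T ≲ V
  ≲-trans {T} (ls , r , refl) (ls′ , r′ , refl) = ls ++ ls′ , Run-++ r r′ , foldl-++ _·_ T ls ls′

  obligations : List (Code × Formula 𝒫)
  obligations = cartesianProduct (allFin m) objectives

  length-obligations : length obligations ≡ m * length objectives
  length-obligations = trans (length-cartesianProduct (allFin m) objectives)
                             (cong (_* length objectives) (length-tabulate {n = m} id))

  contract : ∀ {y} (x₀<y : x₀ < y) → 𝓢 , [ x₀ , y ]⟨ x₀<y ⟩ ⊨ φ →
             ∃[ 𝓒 ] ∃[ ỹ₀ ] ∃[ ỹ ]
               Periodic {φ = φ} 𝓒 ỹ₀ ỹ × 𝓒 Features φ × ỹ₀ < 2 ^ m ×
               ỹ ≤ m * length objectives * (2 ^ m * m) + 2 ^ m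
  contract x₀<y sat
    with T* , (u₀ , u₀-run , u₀-end) , T*-terminal ←
           terminal em encode encode-injective ≲-refl (λ {T} → ≲-trans {T}) ⊥
    with u , u-run , u-end , u-short ← shorten encode encode-injective u₀-run
    with s , T*-realised ← subst (λ T → ∃[ s ] Realises s T) u₀-end
           (Run⇒Realises (x₀ , inj₂ refl , λ ∈⊥ → contradiction ∈⊥ ∉⊥) u₀-run)
    -- One letter is read in advance, so that `w` is nonempty even if nothing is requested.
    -- Obligations are then imposed on the images under `δ l₀`.
    with l₀ , l₀-valid ← letterAt s id , letterAt-valid s id T*-realised
    with w₁ , w₁-run , w₁-short , fulfilled ←
           fulfilAll (δ l₀) obligations
             (All.tabulate (λ o∈ → proj₂ (∈-cartesianProduct⁻ (allFin m) objectives o∈)))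
             (Valid⇒Realises l₀-valid)
    -- Terminality of `T*` gives the way back from the set that `l₀ ∷ w₁` reaches.
    with w₀ , w₀-run , w₀-end ← T*-terminal _ (l₀ ∷ w₁ , l₀-valid ∷ w₁-run , refl)
    with w₂ , w₂-run , w₂-end , w₂-short ← shorten encode encode-injective w₀-run
    = U.structure , length u , length (l₀ ∷ w₁ ++ w₂) , U.structure-periodic ,
      U.structure-features x₀<y sat , u-short , period≤
    where
    fulfils : ∀ {b α} → b ∈ˢ T* → α ∈ˡ objectives → b ⊩ ⟨ B̄ ⟩ α → Fulfils (l₀ ∷ w₁ ++ w₂) b α
    fulfils {b} b∈ α∈ req with persist l₀-valid b∈ α∈ req
    ... | inj₁ a    = inj₁ a
    ... | inj₂ req′ = inj₂ (Fulfils-++ˡ w₁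
      (All.lookup fulfilled (∈-cartesianProduct⁺ (∈-allFin b) α∈) (δ∈· {T*} l₀ b∈) req′))

    module U = Unrolling T* u l₀ (w₁ ++ w₂) u-run (trans u-end u₀-end)
      (l₀-valid ∷ Run-++ w₁-run w₂-run)
      (trans (foldl-++ _·_ (T* · l₀) w₁ w₂) (trans w₂-end w₀-end)) fulfils

    period≤ : length (l₀ ∷ w₁ ++ w₂) ≤ m * length objectives * (2 ^ m * m) + 2 ^ m
    period≤ = begin
      suc (length (w₁ ++ w₂))                          ≡⟨ cong suc (length-++ w₁) ⟩
      suc (length w₁ + length w₂)                      ≡⟨ +-suc (length w₁) (length w₂) ⟨
      -- The strict bound on the way back absorbs the letter `l₀`.
      length w₁ + suc (length w₂)                      ≤⟨ +-mono-≤ w₁-short w₂-short ⟩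
      length obligations * (2 ^ m * m) + 2 ^ m
        ≡⟨ cong (λ k → k * (2 ^ m * m) + 2 ^ m) length-obligations ⟩
      m * length objectives * (2 ^ m * m) + 2 ^ m      ∎
      where open ≤-Reasoning

-- Arithmetic of the bounds

-- The induction starts at 7, the value of `7 * size _≟_ φ` for the smallest possible size 1.
1+2k≤2^k : ∀ {k} → 7 ≤ k → suc (2 * k) ≤ 2 ^ k
1+2k≤2^k 7≤k with j , refl ← m≤n⇒∃[o]m+o≡n 7≤k = go j
  where
  go : ∀ j → suc (2 * (7 + j)) ≤ 2 ^ (7 + j)
  go zero    = ≤ᵇ⇒≤ 15 128 _
  go (suc j) = begin
    suc (2 * (7 + suc j))              ≡⟨ cong suc (*-suc 2 (7 + j)) ⟩
    2 + suc (2 * (7 + j))              ≤⟨ +-mono-≤ (≤-trans (s≤s (s≤s z≤n)) (go j)) (go j) ⟩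
    2 ^ (7 + j) + 2 ^ (7 + j)          ≡⟨ cong (2 ^ (7 + j) +_) (+-identityʳ _) ⟨
    2 * 2 ^ (7 + j)                    ∎
    where open ≤-Reasoning

-- Since `m` is a power of two, so is `2 * (m * m)`; it remains to compare the exponents `2k + 1`
-- and `2 ^ k`.
1+m²<2^m : ∀ {k} → 7 ≤ k → let m = 2 ^ k in suc (m * m) < 2 ^ m
1+m²<2^m {k} 7≤k = begin
  2 + m * m          ≤⟨ +-monoˡ-≤ (m * m) (≤-trans 2≤m (m≤m*n m m {{m^n≢0 2 k}})) ⟩
  m * m + m * m      ≡⟨ cong₂ _+_ m*m≡ m*m≡ ⟩
  2 ^ (2 * k) + 2 ^ (2 * k)  ≡⟨ cong (2 ^ (2 * k) +_) (+-identityʳ _) ⟨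
  2 ^ suc (2 * k)    ≤⟨ ^-monoʳ-≤ 2 (1+2k≤2^k 7≤k) ⟩
  2 ^ m              ∎
  where
  open ≤-Reasoning
  m = 2 ^ k
  2≤m : 2 ≤ m
  2≤m = ^-monoʳ-≤ 2 (≤-trans (s≤s z≤n) 7≤k)
  m*m≡ : m * m ≡ 2 ^ (2 * k)
  m*m≡ = trans (sym (^-distribˡ-+-* 2 k k)) (cong (λ i → 2 ^ (k + i)) (sym (+-identityʳ k)))

-- Raising the summand `S` to `N * S` lets `N * S` be factored out of the sum. The cofactor
-- `m * m + 1` is less than `S`.
period-bound : ∀ {k} N .{{_ : NonZero N}} → 7 ≤ k → let m = 2 ^ k; S = 2 ^ m in
               m * N * (S * m) + S < N * S * S
period-bound {k} N 7≤k = begin-strict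
  m * N * (S * m) + S          ≤⟨ +-monoʳ-≤ _ (m≤n*m S N) ⟩
  m * N * (S * m) + N * S      ≡⟨ regroup m N S ⟩
  N * S * suc (m * m)          <⟨ *-monoʳ-< (N * S) {{m*n≢0 N S {{it}} {{m^n≢0 2 m}}}} (1+m²<2^m 7≤k) ⟩
  N * S * S                    ∎
  where
  open ≤-Reasoning
  m = 2 ^ k
  S = 2 ^ m
  regroup : ∀ m N S → m * N * (S * m) + N * S ≡ N * S * suc (m * m)
  regroup = solve-∀

-- Relevant formulas and truth codes

module Relevant {𝒫 : Set} (_≟_ : DecidableEquality 𝒫) (φ : Formula 𝒫) where

  -- This is where the 7 comes from: one copy of the subformulas, and three modalities applied to
  -- twice as many objectives. A negated subformula needs no bit of its own, its truth being fixed
  -- by that of the subformula.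
  distinct objectives relevant : List (Formula 𝒫)
  distinct   = deduplicate (≡-decᶠ _≟_) (subformulas φ)
  objectives = distinct ++ map ∼_ distinct
  relevant   = distinct ++ map ⟨ A ⟩_ objectives ++ map ⟨ B ⟩_ objectives ++ map ⟨ B̄ ⟩_ objectives

  length-objectives : length objectives ≡ 2 * size _≟_ φ
  length-objectives = begin
    length objectives                        ≡⟨ length-++ distinct ⟩
    length distinct + length (map ∼_ distinct) ≡⟨ cong (length distinct +_) (length-map ∼_ distinct) ⟩
    length distinct + length distinct        ≡⟨ cong (length distinct +_) (+-identityʳ _) ⟨
    2 * length distinct                      ∎
    where open ≡-Reasoning

  length-relevant : length relevant ≡ 7 * size _≟_ φ
  length-relevant = begin
    length relevant
      ≡⟨ length-++ distinct ⟩
    n + length (map ⟨ A ⟩_ objectives ++ map ⟨ B ⟩_ objectives ++ map ⟨ B̄ ⟩_ objectives)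
      ≡⟨ cong (n +_) (length-++ (map ⟨ A ⟩_ objectives)) ⟩
    n + (length (map ⟨ A ⟩_ objectives) + length (map ⟨ B ⟩_ objectives ++ map ⟨ B̄ ⟩_ objectives))
      ≡⟨ cong (λ k → n + (length (map ⟨ A ⟩_ objectives) + k)) (length-++ (map ⟨ B ⟩_ objectives)) ⟩
    n + (length (map ⟨ A ⟩_ objectives) + (length (map ⟨ B ⟩_ objectives) + length (map ⟨ B̄ ⟩_ objectives)))
      ≡⟨ cong (n +_) (cong₂ _+_ (≡2n A) (cong₂ _+_ (≡2n B) (≡2n B̄))) ⟩
    n + (2 * n + (2 * n + 2 * n))
      ≡⟨ collect n ⟩
    7 * n ∎
    where
    open ≡-Reasoning
    n = size _≟_ φ
    ≡2n : ∀ R → length (map ⟨ R ⟩_ objectives) ≡ 2 * n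
    ≡2n R = trans (length-map ⟨ R ⟩_ objectives) length-objectives
    collect : ∀ n → n + (2 * n + (2 * n + 2 * n)) ≡ 7 * n
    collect = solve-∀

  distinct⁺ : ∀ {α} → α ∈ˡ subformulas φ → α ∈ˡ distinct
  distinct⁺ = ∈-deduplicate⁺ (≡-decᶠ _≟_)

  ⟨⟩-relevant : ∀ R {α} → α ∈ˡ objectives → ⟨ R ⟩ α ∈ˡ relevant
  ⟨⟩-relevant A α∈ = ∈-++⁺ʳ distinct (∈-++⁺ˡ (∈-map⁺ ⟨ A ⟩_ α∈))
  ⟨⟩-relevant B α∈ =
    ∈-++⁺ʳ distinct (∈-++⁺ʳ (map ⟨ A ⟩_ objectives) (∈-++⁺ˡ (∈-map⁺ ⟨ B ⟩_ α∈)))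
  ⟨⟩-relevant B̄ α∈ =
    ∈-++⁺ʳ distinct (∈-++⁺ʳ (map ⟨ A ⟩_ objectives)
      (∈-++⁺ʳ (map ⟨ B ⟩_ objectives) (∈-map⁺ ⟨ B̄ ⟩_ α∈)))

  size-nonZero : NonZero (size _≟_ φ)
  size-nonZero with distinct | distinct⁺ (∈-subformulas-refl φ)
  ... | _ ∷ _ | _ = _

module TruthCode (em : ExcludedMiddle 0ℓ) {𝒫 : Set} (𝓢 : InfiniteIntervalStructure 𝒫)
                 (relevant : List (Formula 𝒫)) where

  truth : Point → Fin (length relevant) → Bool
  truth p i = does (em {𝓢 , p ⊨ lookupˡ relevant i})

  code : Point → Fin (2 ^ length relevant)
  code p = encode (tabulate (truth p))

  truth-≡ : ∀ {p q} → code p ≡ code q → ∀ i → truth p i ≡ truth q i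
  truth-≡ {p} {q} eq i = begin
    truth p i                      ≡⟨ lookup∘tabulate (truth p) i ⟨
    lookup (tabulate (truth p)) i
      ≡⟨ cong (λ v → lookup v i) (encode-injective {u = tabulate (truth p)} {tabulate (truth q)} eq) ⟩
    lookup (tabulate (truth q)) i  ≡⟨ lookup∘tabulate (truth q) i ⟩
    truth q i                      ∎
    where open ≡-Reasoning

  code-determines : ∀ {α} → α ∈ˡ relevant → ∀ {p q} → code p ≡ code q → 𝓢 , p ⊨ α → 𝓢 , q ⊨ α
  code-determines α∈ {p} {q} eq a rewrite lookup-index α∈
    with em {𝓢 , q ⊨ lookupˡ relevant (index α∈)} | truth-≡ {p} {q} eq (index α∈)
  ... | yes b | _ = b
  ... | no _  | e with () ← trans (sym e) (dec-true em a)

-- The equivalence with explicit bounds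

satisfies⇒periodic :
  ExcludedMiddle 0ℓ → ∀ {𝒫 : Set} (_≟_ : DecidableEquality 𝒫) (φ : Formula 𝒫) →
  ∀ 𝓢 → 𝓢 Satisfies φ →
  let n = size _≟_ φ; S = 2 ^ (2 ^ (7 * n)) in
  ∃[ 𝓒 ] ∃[ ỹ₀ ] ∃[ ỹ ] Periodic {φ = φ} 𝓒 ỹ₀ ỹ × 𝓒 Features φ × ỹ₀ < S × ỹ < 2 * n * S * S
satisfies⇒periodic em {𝒫} _≟_ φ 𝓢 (p@([ x₀ , _ ]⟨ _ ⟩) , sat)
  = let 𝓒 , ỹ₀ , ỹ , periodic , features , ỹ₀< , ỹ≤ = contract (left<right′ p) sat
    in 𝓒 , ỹ₀ , ỹ , periodic , features ,
       subst (λ k → ỹ₀ < 2 ^ (2 ^ k)) length-relevant ỹ₀< ,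
       ≤-<-trans (subst₂ (λ k N → ỹ ≤ 2 ^ k * N * (2 ^ (2 ^ k) * 2 ^ k) + 2 ^ (2 ^ k))
                   length-relevant length-objectives ỹ≤)
         (period-bound (2 * size _≟_ φ) {{m*n≢0 2 _ {{_}} {{size-nonZero}}}} (m≤m*n 7 _ {{size-nonZero}}))
  where
  open Relevant _≟_ φ
  open TruthCode em 𝓢 relevant

  determined : ∀ {α} → α ∈ˡ objectives → ∀ {p q} → code p ≡ code q → 𝓢 , p ⊨ α → 𝓢 , q ⊨ α
  determined α∈ eq a with ∈-++⁻ distinct α∈
  ... | inj₁ α∈ᴰ = code-determines (∈-++⁺ˡ α∈ᴰ) eq a
  ... | inj₂ ∼d∈ with d , d∈ , refl ← ∈-map⁻ ∼_ ∼d∈ = a ∘ code-determines (∈-++⁺ˡ d∈) (sym eq)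

  open Contraction em φ 𝓢 x₀ code objectives
    (∈-++⁺ˡ ∘ distinct⁺) (∈-++⁺ʳ distinct ∘ ∈-map⁺ ∼_ ∘ distinct⁺)
    determined (λ R α∈ → code-determines (⟨⟩-relevant R α∈))
    using (contract)

theorem2 : ExcludedMiddle 0ℓ →
    ∀ {𝒫 : Set} (_≟_ : DecidableEquality 𝒫) (φ : Formula 𝒫) →
    (∃[ 𝓢 ] 𝓢 Satisfies φ)
    ⇔
    (∃[ 𝓒 ] ∃[ ỹ₀ ] ∃[ ỹ ]
      Periodic {φ = φ} 𝓒 ỹ₀ ỹ
      × 𝓒 Features φ
      × ỹ₀ < 2 ^ (2 ^ (7 * size _≟_ φ))
      × ỹ < 2 * size _≟_ φ * 2 ^ (2 ^ (7 * size _≟_ φ)) * 2 ^ (2 ^ (7 * size _≟_ φ)))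
theorem2 em _≟_ φ = mk⇔
  (λ (𝓢 , sat) → satisfies⇒periodic em _≟_ φ 𝓢 sat)
  (λ (𝓒 , _ , _ , _ , features , _) → intervals em 𝓒 , features⇒satisfies em 𝓒 features)
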